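{- Let $T$ be a complete open $\mathcal{L}$-theory of topological fields of characteristic $0$ that satisfies $(\dagger)_{large}$, where the relation symbols of $\mathcal{L}$ satisfy $(\dagger)$. Assume that $T$ admits quantifier elimination in $\mathcal{L}$. Let $\tilde T$ be a complete theory of Boolean algebras and let $\mathcal{A}$ be a model of $\Gamma^e_{\tilde T}(T^*_\delta)$, with subring of constants $C_{\mathcal{A}}=\{a\in A:\delta(a)=0\}$. Then $(\mathcal{A},C_{\mathcal{A}})$ is a dense pair of models of $\Gamma^e_{\tilde T}(T)$, and hence an elementary pair, i.e. $C_{\mathcal{A}}\preceq\mathcal{A}$ as $\mathcal{L}$-structures.
   Context: Open theories. $\mathcal{L}$ is an expansion, by relation symbols and constants only, of the language of fields $\{+,-,\cdot,{}^{ -1},0,1\}$ (with $0^{ -1}=0$). A complete $\mathcal{L}$-theory $T$ of fields of characteristic $0$ is an open theory of topological fields if there is an $\mathcal{L}$-formula $\chi(x,z)$ such that in each $K\models T$ the sets $\chi(K,b)$ containing $0$ ($b$ a tuple of $K$) form a basis of neighbourhoods of $0$ of a non-discrete Hausdorff field topology, and every definable subset of $K^n$ is a finite union of sets $Z\cap U$ with $Z$ Zariski closed and $U$ definable and open. In models of $T$, model-theoretic algebraic closure $\mathrm{acl}$ coincides with field-theoretic relative algebraic closure (over the constants). $(\dagger)$: for each relation symbol $r(\bar x)$ of $\mathcal{L}$ there is a positive existential $\mathcal{L}$-formula equivalent to $\neg r(\bar x)$ modulo $T$. $(\dagger)_{large}$: every model $\mathcal{K}$ of $T$ has an elementary extension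 equipped with a henselian valuation whose topology coincides with the definable topology. $T_\delta$ is the theory, in $\mathcal{L}_\delta=\mathcal{L}\cup\{\delta\}$, of models of $T$ with a derivation $\delta$. $T^*_\delta$ is $T_\delta$ together with the scheme (DL): for every differential polynomial $q(y)$ over $K$ in one variable, of order $m\ge1$, with separant $s_q=\partial q/\partial\delta^m(y)$ and associated ordinary polynomials $q^*,s_q^*$ in $y_0,\dots,y_m$, for every $\bar a\in K^{m+1}$ with $q^*(\bar a)=0\neq s_q^*(\bar a)$ and every neighbourhood $W$ of $\bar a$, there is $b\in K$ with $q(b)=0\ne s_q(b)$ and $(b,\delta(b),\dots,\delta^m(b))\in W$. Boolean products. A subdirect product $\mathcal{A}=\prod^s_{x\in X}\mathcal{A}_x$ is a substructure of $\prod_{x\in X}\mathcal{A}_x$ projecting onto each factor. $[\varphi(\bar f)]=\{x\in X:\mathcal{A}_x\models\varphi(\bar f(x))\}$. A Boolean space is a totally disconnected compact Hausdorff space. For a theory $T_0$ in a language $\mathcal{L}'$, $\Gamma^e_{\tilde T}(T_0)$ is the class (and its theory) of all subdirect products with $\mathcal{A}_x\models T_0$, $X=\mathcal{X}(\mathcal{A})$ a Boolean space whose algebra of clopen sets $\mathcal{X}(\mathcal{A})^*$ is a model of $\tilde T$, such that (i) (patchwork) for all $f,g\in A$ and clopen $U$ there is $h\in A$ with $U\subseteq[f=h]$, $X\setminus U\subseteq[g=h]$; (ii) $[\varphi(\bar f)]$ is clopen for every $\mathcal{L}'$-formula $\varphi$ and tuple $\bar f$ from $A$. Models are taken represented as such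 products. Topology on $\mathcal{A}\models\Gamma^e(T)$. Let $p$ be the binary function given coordinatewise by $p(a,b)=a$ if $b=0$ and $p(a,b)=0$ otherwise, and $\mathcal{L}_p=\mathcal{L}\cup\{p\}$. It is assumed that $\chi$ is equivalent to a positive primitive existential $\mathcal{L}_p$-formula $\chi_p$ such that $\mathcal{A}\models\chi_p(a,b)$ iff $[\chi(a,b)]=X$. Basic neighbourhoods of $0$ in $A$ are the sets $\chi_p(A,b)$ with $\chi_p(0,b)$ true; basic neighbourhoods of $r$ are their translates by $r$. Dense pairs of boolean products. Let $\mathcal{A}\models\Gamma^e(T)$, $X=X(\mathcal{A})$, and let $\mathcal{D}$ be an $\mathcal{L}$-substructure. Let $\mathcal{D}_x\subseteq\mathcal{A}_x$ be the substructure with domain $\{d(x):d\in D\}$, so $\mathcal{D}=\prod^s_{x\in X}\mathcal{D}_x$, and $[\varphi(\bar f)]^{\mathcal{D}}=\{x\in X:\mathcal{D}_x\models\varphi(\bar f(x))\}$ for $\bar f$ from $D$. $\mathcal{D}$ is $\mathrm{acl}$-closed in $\mathcal{A}$ if each $\mathcal{D}_x$ is $\mathrm{acl}$-closed in $\mathcal{A}_x$. We say $\mathcal{D}\models\Gamma^e(T)$ with respect to $\mathcal{X}(\mathcal{D})^*$ if every $[\varphi(\bar f)]^{\mathcal{D}}$ ($\varphi$ an $\mathcal{L}$-formula, $\bar f$ from $D$) is in $\mathcal{X}(\mathcal{A})^*$, in which case $\mathcal{X}(\mathcal{D})^*$ denotes the Boolean subalgebra of all these sets, and the patchwork property holds in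 $\mathcal{D}$ for $U\in\mathcal{X}(\mathcal{D})^*$. Then $(\mathcal{A},\mathcal{D})$ is a dense pair if moreover: (D1) $\mathcal{X}(\mathcal{D})^*\preceq\mathcal{X}(\mathcal{A})^*$; (D2) $\mathcal{D}$ is $\mathrm{acl}$-closed in $\mathcal{A}$; (D3) $(r+\chi_p(A,b))\cap D\neq\emptyset$ for all $r\in A$ and all tuples $b$ of $A$ with $\chi_p(0,b)$ true; (D4) for all $x\in X$ and $e\in\mathcal{X}(\mathcal{A})^*$ with $x\in e$ there is $\tilde e\in\mathcal{X}(\mathcal{D})^*$ with $x\in\tilde e\subseteq e$.
   Formalization: It is additionally assumed that δ vanishes on the interpretations of the constant symbols of 𝓛 in 𝒜; otherwise C_𝒜 is not an 𝓛-substructure (e.g. real closed fields with a named transcendental c and δ(c)=1). -}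

module Defs where

open import Level using (Level; Setω; Lift; lift; _⊔_; 0ℓ) renaming (suc to lsuc)
open import Algebra.Core using (Op₂)
open import Algebra.Definitions using (Congruent₂)
open import Algebra.Bundles using (AbelianGroup)
open import Algebra.Structures using (IsCommutativeRing)
open import Algebra.Lattice.Structures using (IsBooleanAlgebra)
open import Axiom.ExcludedMiddle using (ExcludedMiddle)
open import Data.Fin.Base using (Fin; zero; suc; toℕ; fromℕ)
open import Data.List.Base using (List; []; _∷_)
open import Data.List.Relation.Unary.All using (All)
open import Data.List.Relation.Unary.Any using (Any)
open import Data.Nat.Base as ℕ using (ℕ; zero; suc)
open import Data.Nat.GeneralisedArithmetic using (iterate)
open import Data.Product.Base using (Σ; ∃; Σ-syntax; ∃-syntax; _×_; _,_; proj₁; proj₂)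
open import Data.Sum.Base using (_⊎_; inj₁; inj₂)
open import Data.Vec.Functional as V using (Vector; _++_)
open import Function.Base using (_∘_)
open import Function.Bundles using (_⇔_)
open import Relation.Binary.Construct.Add.Supremum.NonStrict as AddSupremum using ()
open import Relation.Binary.Construct.Add.Supremum.Equality as AddSupremumEq using ()
open import Relation.Binary.Core using (Rel)
open import Relation.Binary.Definitions using (_Respects_)
open import Relation.Binary.PropositionalEquality.Core using (_≡_)
open import Relation.Binary.Structures using (IsEquivalence; IsTotalOrder)
open import Relation.Nullary.Construct.Add.Supremum using (_⁺; [_]; ⊤⁺)
open import Relation.Nullary.Decidable.Core using (yes; no; _×-dec_; _⊎-dec_; ¬?)
open import Relation.Nullary.Negation.Core using (¬_; contradiction)
open import Relation.Unary using (Pred; _∈_; _⊆_; _≐_; _∩_; _∪_; ∁; ⋃; Decidable; Empty)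

private
  variable
    l c r ℓ : Level
    k m n   : ℕ

infixr 5 _∷ᵛ_
_∷ᵛ_ : {A : Set c} → A → Vector A n → Vector A (suc n)
_∷ᵛ_ = V._∷_

[]ᵛ : {A : Set c} → Vector A 0
[]ᵛ = V.[]

-- The metatheory is classical; this is passed to the theorem as a hypothesis.
Classical : Setω
Classical = ∀ {a : Level} → ExcludedMiddle a

------------------------------------------------------------------------
-- First-order logic

record Language (l : Level) : Set (lsuc l) where
  field
    Func : ℕ → Set l
    Rel′ : ℕ → Set l

open Language

data Term (L : Language l) (n : ℕ) : Set l where
  var : Fin n → Term L n
  fn  : Func L k → (Fin k → Term L n) → Term L n

-- ∃′ and ∀′ bind variable 0.
data Formula (L : Language l) (n : ℕ) : Set l where
  _≈′_      : Term L n → Term L n → Formula L n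
  rel′      : Rel′ L k → (Fin k → Term L n) → Formula L n
  ¬′_       : Formula L n → Formula L n
  _∧′_ _∨′_ : Formula L n → Formula L n → Formula L n
  ∃′_ ∀′_   : Formula L (suc n) → Formula L n

Sentence : Language l → Set l
Sentence L = Formula L 0

-- Equality is interpreted by a congruence, so that (sub)products of
-- structures can be formed without function extensionality.
record Structure (L : Language l) (c r : Level) : Set (l ⊔ lsuc (c ⊔ r)) where
  infix 4 _≈_
  field
    Carrier       : Set c
    _≈_           : Rel Carrier r
    isEquivalence : IsEquivalence _≈_
    fun           : Func L k → Vector Carrier k → Carrier
    fun-cong      : (F : Func L k) {u v : Vector Carrier k} →
                    (∀ i → u i ≈ v i) → fun F u ≈ fun F v
    rel           : Rel′ L k → Vector Carrier k → Set r
    rel-resp      : (R : Rel′ L k) {u v : Vector Carrier k} →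
                    (∀ i → u i ≈ v i) → rel R u → rel R v

  open IsEquivalence isEquivalence public

open Structure using () renaming (Carrier to ∣_∣)

module _ {L : Language l} (K : Structure L c r) where
  open Structure K

  ⟦_⟧ : Term L n → Vector ∣ K ∣ n → ∣ K ∣
  ⟦ var i ⟧   v = v i
  ⟦ fn F ts ⟧ v = fun F (λ i → ⟦ ts i ⟧ v)

infix 4 _⊨_[_]
_⊨_[_] : {L : Language l} (K : Structure L c r) → Formula L n →
         Vector ∣ K ∣ n → Set (c ⊔ r)
_⊨_[_] {c = c} K (s ≈′ t) v = Lift c (Structure._≈_ K (⟦ K ⟧ s v) (⟦ K ⟧ t v))
_⊨_[_] {c = c} K (rel′ R ts) v = Lift c (Structure.rel K R (λ i → ⟦ K ⟧ (ts i) v))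
K ⊨ ¬′ φ [ v ]   = ¬ (K ⊨ φ [ v ])
K ⊨ φ ∧′ ψ [ v ] = (K ⊨ φ [ v ]) × (K ⊨ ψ [ v ])
K ⊨ φ ∨′ ψ [ v ] = (K ⊨ φ [ v ]) ⊎ (K ⊨ ψ [ v ])
K ⊨ ∃′ φ [ v ]   = ∃[ a ] (K ⊨ φ [ a ∷ᵛ v ])
K ⊨ ∀′ φ [ v ]   = ∀ a → K ⊨ φ [ a ∷ᵛ v ]

Theory : Language l → (t : Level) → Set (l ⊔ lsuc t)
Theory L t = Pred (Sentence L) t

infix 4 _⊨ᵀ_
_⊨ᵀ_ : {L : Language l} {t : Level} → Structure L c r → Theory L t → Set (l ⊔ c ⊔ r ⊔ t)
K ⊨ᵀ T = ∀ φ → φ ∈ T → K ⊨ φ [ []ᵛ ]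

Complete : {L : Language l} {t : Level} (c r : Level) → Theory L t → Set (l ⊔ t ⊔ lsuc (c ⊔ r))
Complete {L = L} c r T =
    (Σ[ K ∈ Structure L c r ] K ⊨ᵀ T)
  × (∀ (φ : Sentence L) →
        (∀ (K : Structure L c r) → K ⊨ᵀ T → K ⊨ φ [ []ᵛ ])
      ⊎ (∀ (K : Structure L c r) → K ⊨ᵀ T → K ⊨ ¬′ φ [ []ᵛ ]))

data Atomic {L : Language l} {n : ℕ} : Formula L n → Set l where
  eqᵃ  : ∀ s t → Atomic (s ≈′ t)
  relᵃ : ∀ {k} (R : Rel′ L k) ts → Atomic (rel′ R ts)

data QuantifierFree {L : Language l} {n : ℕ} : Formula L n → Set l where
  atom : ∀ {φ} → Atomic φ → QuantifierFree φ
  neg  : ∀ {φ} → QuantifierFree φ → QuantifierFree (¬′ φ)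
  and  : ∀ {φ ψ} → QuantifierFree φ → QuantifierFree ψ → QuantifierFree (φ ∧′ ψ)
  or   : ∀ {φ ψ} → QuantifierFree φ → QuantifierFree ψ → QuantifierFree (φ ∨′ ψ)

data PositiveExistential {L : Language l} : Formula L n → Set l where
  atom : {φ : Formula L n} → Atomic φ → PositiveExistential φ
  and  : {φ ψ : Formula L n} → PositiveExistential φ → PositiveExistential ψ → PositiveExistential (φ ∧′ ψ)
  or   : {φ ψ : Formula L n} → PositiveExistential φ → PositiveExistential ψ → PositiveExistential (φ ∨′ ψ)
  ex   : {φ : Formula L (suc n)} → PositiveExistential φ → PositiveExistential (∃′ φ)

data AtomicConjunction {L : Language l} {n : ℕ} : Formula L n → Set l where
  atom : ∀ {φ} → Atomic φ → AtomicConjunction φ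
  and  : ∀ {φ ψ} → AtomicConjunction φ → AtomicConjunction ψ → AtomicConjunction (φ ∧′ ψ)

data PositivePrimitive {L : Language l} : Formula L n → Set l where
  matrix : {φ : Formula L n} → AtomicConjunction φ → PositivePrimitive φ
  ex     : {φ : Formula L (suc n)} → PositivePrimitive φ → PositivePrimitive (∃′ φ)

-- The quantifiers over models of T below range over structures with carrier
-- and relations in Set ℓ, the level of the language; by Löwenheim–Skolem this
-- does not affect semantic consequence.
EliminatesQuantifiers : {L : Language ℓ} → Theory L ℓ → Set (lsuc ℓ)
EliminatesQuantifiers {ℓ} {L} T =
  ∀ {n} (φ : Formula L n) → Σ[ ψ ∈ Formula L n ] QuantifierFree ψ ×
    (∀ (K : Structure L ℓ ℓ) → K ⊨ᵀ T → ∀ v → (K ⊨ φ [ v ]) ⇔ (K ⊨ ψ [ v ]))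

-- The condition (†).
NegatedRelationsPositive : {L : Language ℓ} → Theory L ℓ → Set (lsuc ℓ)
NegatedRelationsPositive {ℓ} {L} T =
  ∀ {n} (R : Rel′ L n) → Σ[ ψ ∈ Formula L n ] PositiveExistential ψ ×
    (∀ (K : Structure L ℓ ℓ) → K ⊨ᵀ T → ∀ v → (K ⊨ ψ [ v ]) ⇔ (¬ Structure.rel K R v))

-- Substructures are given by their domains.
record IsSubstructure {L : Language l} {p : Level} (K : Structure L c r)
                      (P : Pred ∣ K ∣ p) : Set (l ⊔ c ⊔ r ⊔ p) where
  open Structure K
  field
    resp   : P Respects _≈_
    closed : (F : Func L k) {v : Vector ∣ K ∣ k} → (∀ i → v i ∈ P) → fun F v ∈ P

module _ {L : Language l} {p : Level} {K : Structure L c r} {P : Pred ∣ K ∣ p}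
         (sub : IsSubstructure K P) where
  open Structure K

  substructure : Structure L (c ⊔ p) r
  substructure = record
    { Carrier       = Σ ∣ K ∣ P
    ; _≈_           = λ a b → proj₁ a ≈ proj₁ b
    ; isEquivalence = record { refl = refl ; sym = sym ; trans = trans }
    ; fun           = λ F v → fun F (proj₁ ∘ v) , IsSubstructure.closed sub F (proj₂ ∘ v)
    ; fun-cong      = λ F → fun-cong F
    ; rel           = λ R v → rel R (proj₁ ∘ v)
    ; rel-resp      = λ R → rel-resp R
    }

  -- substructure ≼ K
  IsElementary : Set (l ⊔ c ⊔ r ⊔ p)
  IsElementary = ∀ {n} (φ : Formula L n) (v : Vector ∣ substructure ∣ n) →
                 (substructure ⊨ φ [ v ]) ⇔ (K ⊨ φ [ proj₁ ∘ v ])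

IsElementaryEmbedding : {L : Language l} (K K′ : Structure L c r) →
                        (∣ K ∣ → ∣ K′ ∣) → Set (l ⊔ c ⊔ r)
IsElementaryEmbedding {L = L} K K′ h =
  ∀ {n} (φ : Formula L n) (v : Vector ∣ K ∣ n) → (K ⊨ φ [ v ]) ⇔ (K′ ⊨ φ [ h ∘ v ])

-- Algebraic closure in the sense of model theory.
acl : {L : Language l} {p : Level} (K : Structure L c r) →
      Pred ∣ K ∣ p → Pred ∣ K ∣ (l ⊔ c ⊔ r ⊔ p)
acl {L = L} K B a =
  ∃[ m ] Σ[ φ ∈ Formula L (suc m) ] Σ[ b ∈ Vector ∣ K ∣ m ]
    (∀ i → b i ∈ B) × (K ⊨ φ [ a ∷ᵛ b ]) ×
    (∃[ k ] Σ[ e ∈ Vector ∣ K ∣ k ]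
      ∀ x → K ⊨ φ [ x ∷ᵛ b ] → ∃[ i ] Structure._≈_ K x (e i))

infixl 6 _⊕_
_⊕_ : Language l → (ℕ → Set l) → Language l
L ⊕ F = record { Func = λ k → Func L k ⊎ F k ; Rel′ = Rel′ L }

reduct : {L : Language l} {F : ℕ → Set l} → Structure (L ⊕ F) c r → Structure L c r
reduct K = record
  { Carrier       = ∣ K ∣
  ; _≈_           = _≈_
  ; isEquivalence = isEquivalence
  ; fun           = λ F → fun (inj₁ F)
  ; fun-cong      = λ F → fun-cong (inj₁ F)
  ; rel           = rel
  ; rel-resp      = rel-resp
  }
  where open Structure K

------------------------------------------------------------------------
-- Topology

record IsTopology {A : Set c} {o : Level} (_≈_ : Rel A r) (Open : Pred (Pred A ℓ) o) :
                  Set (c ⊔ r ⊔ lsuc ℓ ⊔ o) where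
  field
    resp  : ∀ {U} → Open U → U Respects _≈_
    ext   : ∀ {U V} → U ≐ V → Open U → Open V
    full  : ∀ {U} → (∀ x → x ∈ U) → Open U
    inter : ∀ {U V} → Open U → Open V → Open (U ∩ V)
    union : ∀ {I : Set ℓ} (U : I → Pred A ℓ) → (∀ i → Open (U i)) → Open (⋃ I U)

module _ {A : Set c} {o : Level} (Open : Pred (Pred A ℓ) o) where

  IsNbhd : A → Pred (Pred A ℓ) (c ⊔ lsuc ℓ ⊔ o)
  IsNbhd x N = ∃[ U ] Open U × x ∈ U × U ⊆ N

  -- The product topology on A ^ n.
  Open^ : (n : ℕ) → Pred (Pred (Vector A n) ℓ) (c ⊔ lsuc ℓ ⊔ o)
  Open^ n W = ∀ v → v ∈ W → Σ[ U ∈ (Fin n → Pred A ℓ) ]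
    (∀ i → Open (U i)) × (∀ i → v i ∈ U i) × (∀ w → (∀ i → w i ∈ U i) → w ∈ W)

  IsContinuous : (Vector A n → A) → Set (c ⊔ lsuc ℓ ⊔ o)
  IsContinuous {n} f = ∀ {U} → Open U → Open^ n (U ∘ f)

  module _ (_≈_ : Rel A r) where

    Hausdorff : Set (c ⊔ r ⊔ lsuc ℓ ⊔ o)
    Hausdorff = ∀ x y → ¬ (x ≈ y) →
      ∃[ U ] ∃[ V ] Open U × Open V × x ∈ U × y ∈ V × Empty (U ∩ V)

    Discrete : Set (c ⊔ r ⊔ lsuc ℓ ⊔ o)
    Discrete = ∀ U → U Respects _≈_ → Open U

    Connected : Pred (Pred A ℓ) (c ⊔ lsuc ℓ ⊔ o)
    Connected S = ∀ {U V} → Open U → Open V → S ⊆ U ∪ V → Empty (S ∩ (U ∩ V)) →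
      Empty (S ∩ U) ⊎ Empty (S ∩ V)

    TotallyDisconnected : Set (c ⊔ r ⊔ lsuc ℓ ⊔ o)
    TotallyDisconnected = ∀ {S} → Connected S → ∀ {x y} → x ∈ S → y ∈ S → x ≈ y

  Compact : Set (c ⊔ lsuc ℓ ⊔ o)
  Compact = ∀ {I : Set ℓ} (U : I → Pred A ℓ) → (∀ i → Open (U i)) →
    (∀ x → ∃[ i ] x ∈ U i) → Σ[ is ∈ List I ] ∀ x → Any (λ i → x ∈ U i) is

  -- Decidability is automatic classically; it expresses U ∪ ∁ U = A, which is
  -- what makes the clopen sets a Boolean algebra.
  IsClopen : Pred (Pred A ℓ) (c ⊔ ℓ ⊔ o)
  IsClopen U = Open U × Open (∁ U) × Decidable U

record BooleanSpace (ℓ : Level) : Set (lsuc (lsuc ℓ)) where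
  field
    Point               : Set ℓ
    Open                : Pred (Pred Point ℓ) (lsuc ℓ)
    isTopology          : IsTopology _≡_ Open
    compact             : Compact Open
    hausdorff           : Hausdorff Open _≡_
    totallyDisconnected : TotallyDisconnected Open _≡_

  Clopen : Pred (Pred Point ℓ) (lsuc ℓ)
  Clopen = IsClopen Open

------------------------------------------------------------------------
-- Boolean algebras

data BAFunc : ℕ → Set where
  join meet  : BAFunc 2
  compl      : BAFunc 1
  top bottom : BAFunc 0

data NoSymbol {l : Level} : ℕ → Set l where

LBA : Language 0ℓ
LBA = record { Func = BAFunc ; Rel′ = NoSymbol }

IsBooleanAlgebraStructure : Structure LBA c r → Set (c ⊔ r)
IsBooleanAlgebraStructure B =
  IsBooleanAlgebra _≈_ (λ a b → fun join (a ∷ᵛ b ∷ᵛ []ᵛ)) (λ a b → fun meet (a ∷ᵛ b ∷ᵛ []ᵛ))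
    (λ a → fun compl (a ∷ᵛ []ᵛ)) (fun top []ᵛ) (fun bottom []ᵛ)
  where open Structure B

module _ (X : BooleanSpace ℓ) where
  open BooleanSpace X
  open IsTopology isTopology hiding (union)
  private
    union : ∀ {U V} → Open U → Open V → Open (U ∪ V)
    union {U} {V} u v =
      ext ( (λ { (lift zero , x) → inj₁ x ; (lift (suc zero) , x) → inj₂ x })
          , (λ { (inj₁ x) → lift zero , x ; (inj₂ x) → lift (suc zero) , x }))
        (IsTopology.union isTopology {I = Lift ℓ (Fin 2)}
          (λ { (lift zero) → U ; (lift (suc zero)) → V })
          (λ { (lift zero) → u ; (lift (suc zero)) → v }))

    op : BAFunc k → Vector (Pred Point ℓ) k → Pred Point ℓ
    op join   U = U zero ∪ U (suc zero)
    op meet   U = U zero ∩ U (suc zero)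
    op compl  U = ∁ (U zero)
    op top    U = λ _ → Lift ℓ (Fin 1)
    op bottom U = λ _ → Lift ℓ (Fin 0)

    op-clopen : (F : BAFunc k) {U : Vector (Pred Point ℓ) k} →
                (∀ i → Clopen (U i)) → Clopen (op F U)
    op-clopen join {U} h with h zero | h (suc zero)
    ... | o , o′ , d | p , p′ , e =
        union o p
      , ext ( (λ { (a , b) (inj₁ x) → a x ; (a , b) (inj₂ y) → b y })
            , (λ f → (f ∘ inj₁) , (f ∘ inj₂))) (inter o′ p′)
      , λ x → d x ⊎-dec e x
    op-clopen meet {U} h with h zero | h (suc zero)
    ... | o , o′ , d | p , p′ , e =
        inter o p
      , ext ((λ { (inj₁ a) (x , _) → a x ; (inj₂ b) (_ , y) → b y }) , back) (union o′ p′)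
      , λ x → d x ×-dec e x
      where
      back : ∁ (U zero ∩ U (suc zero)) ⊆ ∁ (U zero) ∪ ∁ (U (suc zero))
      back {x} f with d x
      ... | yes a = inj₂ (λ b → f (a , b))
      ... | no ¬a = inj₁ ¬a
    op-clopen compl {U} h with h zero
    ... | o , o′ , d = o′ , ext ((λ a f → f a) , back) o , λ x → ¬? (d x)
      where
      back : ∁ (∁ (U zero)) ⊆ U zero
      back {x} f with d x
      ... | yes a = a
      ... | no ¬a = contradiction ¬a f
    op-clopen top h =
        full (λ _ → lift zero)
      , ext ((λ { (() , _) }) , λ f → contradiction (lift zero) f)
          (IsTopology.union isTopology {I = Lift ℓ (Fin 0)} (λ ()) (λ ()))
      , λ _ → yes (lift zero)
    op-clopen bottom h =
        ext ((λ { (() , _) }) , (λ ()))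
          (IsTopology.union isTopology {I = Lift ℓ (Fin 0)} (λ ()) (λ ()))
      , full (λ _ ())
      , λ _ → no (λ ())

    op-cong : (F : BAFunc k) {U V : Vector (Pred Point ℓ) k} →
              (∀ i → U i ≐ V i) → op F U ≐ op F V
    op-cong join h =
        (λ { (inj₁ x) → inj₁ (proj₁ (h zero) x) ; (inj₂ x) → inj₂ (proj₁ (h (suc zero)) x) })
      , (λ { (inj₁ x) → inj₁ (proj₂ (h zero) x) ; (inj₂ x) → inj₂ (proj₂ (h (suc zero)) x) })
    op-cong meet h =
        (λ { (x , y) → proj₁ (h zero) x , proj₁ (h (suc zero)) y })
      , (λ { (x , y) → proj₂ (h zero) x , proj₂ (h (suc zero)) y })
    op-cong compl h = (λ f x → f (proj₂ (h zero) x)) , (λ f x → f (proj₁ (h zero) x))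
    op-cong top h = (λ x → x) , (λ x → x)
    op-cong bottom h = (λ x → x) , (λ x → x)

  clopenAlgebra : Structure LBA (lsuc ℓ) ℓ
  clopenAlgebra = record
    { Carrier       = Σ (Pred Point ℓ) Clopen
    ; _≈_           = λ U V → proj₁ U ≐ proj₁ V
    ; isEquivalence = record
      { refl  = (λ x → x) , (λ x → x)
      ; sym   = λ (p , q) → q , p
      ; trans = λ (p , q) (p′ , q′) → (p′ ∘ p) , (q ∘ q′)
      }
    ; fun           = λ F U → op F (proj₁ ∘ U) , op-clopen F (proj₂ ∘ U)
    ; fun-cong      = λ F → op-cong F
    ; rel           = λ ()
    ; rel-resp      = λ ()
    }

------------------------------------------------------------------------
-- Boolean products

record SubdirectProduct (L : Language l) (ℓ : Level) : Set (l ⊔ lsuc (lsuc ℓ)) where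
  field
    space : BooleanSpace ℓ

  open BooleanSpace space public

  field
    fibre    : Point → Structure L ℓ ℓ
    Element  : Pred (∀ x → ∣ fibre x ∣) ℓ
    resp     : ∀ {f g} → (∀ x → Structure._≈_ (fibre x) (f x) (g x)) → Element f → Element g
    closed   : (F : Func L k) {f : Fin k → ∀ x → ∣ fibre x ∣} → (∀ i → Element (f i)) →
               Element (λ x → Structure.fun (fibre x) F (λ i → f i x))
    projects : ∀ x (a : ∣ fibre x ∣) →
               ∃[ f ] Element f × Structure._≈_ (fibre x) (f x) a

  structure : Structure L ℓ ℓ
  structure = record
    { Carrier       = Σ _ Element
    ; _≈_           = λ f g → ∀ x → Structure._≈_ (fibre x) (proj₁ f x) (proj₁ g x)
    ; isEquivalence = record
      { refl  = λ x → Structure.refl (fibre x)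
      ; sym   = λ p x → Structure.sym (fibre x) (p x)
      ; trans = λ p q x → Structure.trans (fibre x) (p x) (q x)
      }
    ; fun           = λ F f → (λ x → Structure.fun (fibre x) F (λ i → proj₁ (f i) x))
                            , closed F (λ i → proj₂ (f i))
    ; fun-cong      = λ F p x → Structure.fun-cong (fibre x) F (λ i → p i x)
    ; rel           = λ R f → ∀ x → Structure.rel (fibre x) R (λ i → proj₁ (f i) x)
    ; rel-resp      = λ R p h x → Structure.rel-resp (fibre x) R (λ i → p i x) (h x)
    }

  [[_]] : Formula L n → Vector ∣ structure ∣ n → Pred Point ℓ
  [[ φ ]] f x = fibre x ⊨ φ [ (λ i → proj₁ (f i) x) ]

  -- [ f = g ]
  Agree : ∣ structure ∣ → ∣ structure ∣ → Pred Point ℓ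
  Agree f g x = Structure._≈_ (fibre x) (proj₁ f x) (proj₁ g x)

reductᴾ : {L : Language l} {F : ℕ → Set l} → SubdirectProduct (L ⊕ F) ℓ → SubdirectProduct L ℓ
reductᴾ 𝒜 = record
  { space    = space
  ; fibre    = λ x → reduct (fibre x)
  ; Element  = Element
  ; resp     = resp
  ; closed   = λ F → closed (inj₁ F)
  ; projects = projects
  }
  where open SubdirectProduct 𝒜

-- Γᵉ(T₀), where T₀ is given through the class Mod of its models.
record Γᵉ {L : Language l} {t : Level} (Mod : Pred (Structure L ℓ ℓ) t)
          (𝒜 : SubdirectProduct L ℓ) : Set (l ⊔ t ⊔ lsuc ℓ) where
  open SubdirectProduct 𝒜
  field
    models    : ∀ x → Mod (fibre x)
    patchwork : ∀ (f g : ∣ structure ∣) {U} → Clopen U →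
                ∃[ h ] (U ⊆ Agree f h) × (∁ U ⊆ Agree g h)
    clopen    : ∀ {n} (φ : Formula L n) f → Clopen ([[ φ ]] f)

record Γᵉ[_] {L : Language l} {t s : Level} (T̃ : Theory LBA s) (Mod : Pred (Structure L ℓ ℓ) t)
             (𝒜 : SubdirectProduct L ℓ) : Set (l ⊔ t ⊔ s ⊔ lsuc ℓ) where
  field
    isΓᵉ    : Γᵉ Mod 𝒜
    algebra : clopenAlgebra (SubdirectProduct.space 𝒜) ⊨ᵀ T̃

------------------------------------------------------------------------
-- Topological fields.  Const and R are the constant and relation symbols by
-- which the language of fields is expanded.

data FieldFunc (Const : Set ℓ) : ℕ → Set ℓ where
  zeroᶠ oneᶠ : FieldFunc Const 0
  negᶠ invᶠ  : FieldFunc Const 1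
  addᶠ mulᶠ  : FieldFunc Const 2
  const      : Const → FieldFunc Const 0

data DerivationSymbol {ℓ : Level} : ℕ → Set ℓ where
  δ : DerivationSymbol 1

data PSymbol {ℓ : Level} : ℕ → Set ℓ where
  𝓅 : PSymbol 2

module _ (Const : Set ℓ) (R : ℕ → Set ℓ) where

  FieldLanguage : Language ℓ
  FieldLanguage = record { Func = FieldFunc Const ; Rel′ = R }

  FieldLanguageδ : Language ℓ
  FieldLanguageδ = FieldLanguage ⊕ DerivationSymbol

  FieldLanguageₚ : Language ℓ
  FieldLanguageₚ = FieldLanguage ⊕ PSymbol

module _ {Const : Set ℓ} {R : ℕ → Set ℓ} where

  private
    L Lδ Lₚ : Language ℓ
    L  = FieldLanguage Const R
    Lδ = FieldLanguageδ Const R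
    Lₚ = FieldLanguageₚ Const R

  module Ops (K : Structure L ℓ ℓ) where
    open Structure K public
    infixl 6 _+_ _-_
    infixl 7 _*_
    infix  8 -_ _⁻¹

    0# 1# : Carrier
    0# = fun zeroᶠ []ᵛ
    1# = fun oneᶠ []ᵛ

    -_ _⁻¹ : Carrier → Carrier
    - a  = fun negᶠ (a ∷ᵛ []ᵛ)
    a ⁻¹ = fun invᶠ (a ∷ᵛ []ᵛ)

    _+_ _-_ _*_ : Carrier → Carrier → Carrier
    a + b = fun addᶠ (a ∷ᵛ b ∷ᵛ []ᵛ)
    a * b = fun mulᶠ (a ∷ᵛ b ∷ᵛ []ᵛ)
    a - b = a + (- b)

    numeral : ℕ → Carrier
    numeral zero    = 0#
    numeral (suc n) = 1# + numeral n

    -- K[y₀,…,yₙ₋₁] as K[y₁,…,yₙ₋₁][y₀]; a polynomial in y₀ is the list of its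
    -- coefficients, constant coefficient first, trailing zeros being allowed.
    Poly : ℕ → Set ℓ
    Poly zero    = Carrier
    Poly (suc n) = List (Poly n)

    eval : ∀ n → Poly n → Vector Carrier n → Carrier
    eval zero    q        v = q
    eval (suc n) []       v = 0#
    eval (suc n) (q ∷ qs) v = eval n q (v ∘ suc) + v zero * eval (suc n) qs v

    0ᵖ : ∀ n → Poly n
    0ᵖ zero    = 0#
    0ᵖ (suc n) = []

    add : ∀ n → Poly n → Poly n → Poly n
    add zero    q        q′         = q + q′
    add (suc n) []       qs′        = qs′
    add (suc n) (q ∷ qs) []         = q ∷ qs
    add (suc n) (q ∷ qs) (q′ ∷ qs′) = add n q q′ ∷ add (suc n) qs qs′

    -- The partial derivative with respect to yᵢ; for i = 0 it is computed by
    -- (q + y₀ · qs)′ = qs + y₀ · qs′.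
    ∂ : ∀ n → Fin n → Poly n → Poly n
    ∂ (suc n) zero    []       = []
    ∂ (suc n) zero    (q ∷ qs) = add (suc n) qs (0ᵖ n ∷ ∂ (suc n) zero qs)
    ∂ (suc n) (suc i) []       = []
    ∂ (suc n) (suc i) (q ∷ qs) = ∂ n i q ∷ ∂ (suc n) (suc i) qs

    -- Belonging to the field-theoretic relative algebraic closure of B ∪ Const.
    -- The L-substructure generated by B, whose elements are the values of
    -- terms at tuples of B, is the subfield generated by B and the constants.
    Generated : Pred Carrier ℓ → Pred Carrier ℓ
    Generated B a = ∃[ m ] Σ[ t ∈ Term L m ] Σ[ b ∈ Vector Carrier m ]
      (∀ i → b i ∈ B) × a ≈ ⟦ K ⟧ t b

    AlgebraicOver : Pred Carrier ℓ → Pred Carrier ℓ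
    AlgebraicOver B a = Σ[ q ∈ Poly 1 ]
      All (Generated B) q × Any (λ e → ¬ (e ≈ 0#)) q × eval 1 q (a ∷ᵛ []ᵛ) ≈ 0#

    ZariskiClosed : Pred (Vector Carrier n) ℓ → Set (lsuc ℓ)
    ZariskiClosed {n} Z = Σ[ I ∈ Set ℓ ] Σ[ q ∈ (I → Poly n) ]
      Z ≐ (λ v → ∀ i → eval n (q i) v ≈ 0#)

    Definable : Pred (Vector Carrier n) ℓ → Set ℓ
    Definable {n} S = ∃[ m ] Σ[ φ ∈ Formula L (n ℕ.+ m) ] Σ[ b ∈ Vector Carrier m ]
      S ≐ (λ v → K ⊨ φ [ v ++ b ])

  record IsFieldOfChar0 (K : Structure L ℓ ℓ) : Set ℓ where
    open Ops K
    field
      isCommutativeRing : IsCommutativeRing _≈_ _+_ _*_ -_ 0# 1#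
      0≉1               : ¬ (0# ≈ 1#)
      inverse           : ∀ a → ¬ (a ≈ 0#) → a * a ⁻¹ ≈ 1#
      0⁻¹≈0             : 0# ⁻¹ ≈ 0#
      char0             : ∀ n → ¬ (numeral (suc n) ≈ 0#)

  record IsFieldTopology {o : Level} (K : Structure L ℓ ℓ)
                         (Open : Pred (Pred ∣ K ∣ ℓ) o) : Set (lsuc ℓ ⊔ o) where
    open Ops K
    field
      isTopology     : IsTopology _≈_ Open
      +-continuous   : IsContinuous Open (fun addᶠ)
      neg-continuous : IsContinuous Open (fun negᶠ)
      *-continuous   : IsContinuous Open (fun mulᶠ)
      -- with respect to the subspace topology on the nonzero elements
      inv-continuous : ∀ {U} → Open U →
        ∃[ V ] Open V × (∀ a → ¬ (a ≈ 0#) → (a ∈ V) ⇔ (a ⁻¹ ∈ U))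

  -- The topology for which the sets a + χ(K,b) with K ⊨ χ(0,b) are the basic
  -- neighbourhoods of a.
  DefinableOpen : Formula L (suc m) → (K : Structure L ℓ ℓ) → Pred (Pred ∣ K ∣ ℓ) ℓ
  DefinableOpen {m} χ K U = ∀ a → a ∈ U → Σ[ b ∈ Vector Carrier m ]
    (K ⊨ χ [ 0# ∷ᵛ b ]) × (∀ y → K ⊨ χ [ (y - a) ∷ᵛ b ] → y ∈ U)
    where open Ops K

  record IsOpenTheory (T : Theory L ℓ) (χ : Formula L (suc m)) : Set (lsuc ℓ) where
    field
      fields        : ∀ K → K ⊨ᵀ T → IsFieldOfChar0 K
      fieldTopology : ∀ K → K ⊨ᵀ T → IsFieldTopology K (DefinableOpen χ K)
      hausdorff     : ∀ K → K ⊨ᵀ T → Hausdorff (DefinableOpen χ K) (Structure._≈_ K)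
      nonDiscrete   : ∀ K → K ⊨ᵀ T → ¬ Discrete (DefinableOpen χ K) (Structure._≈_ K)
      basis         : ∀ K → K ⊨ᵀ T → let open Ops K in
        (∀ b → K ⊨ χ [ 0# ∷ᵛ b ] → IsNbhd (DefinableOpen χ K) 0# (λ y → K ⊨ χ [ y ∷ᵛ b ]))
        × (∀ N → IsNbhd (DefinableOpen χ K) 0# N →
             ∃[ b ] (K ⊨ χ [ 0# ∷ᵛ b ]) × (λ y → K ⊨ χ [ y ∷ᵛ b ]) ⊆ N)
      definableSets : ∀ K → K ⊨ᵀ T → let open Ops K in
        ∀ {n} (S : Pred (Vector Carrier n) ℓ) → Definable S →
        ∃[ k ] Σ[ Z ∈ (Fin k → Pred (Vector Carrier n) ℓ) ] Σ[ U ∈ (Fin k → Pred (Vector Carrier n) ℓ) ]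
          (∀ i → ZariskiClosed (Z i) × Definable (U i) × Open^ (DefinableOpen χ K) n (U i))
          × S ≐ ⋃ (Fin k) (λ i → Z i ∩ U i)

  AclIsFieldAlgebraic : Theory L ℓ → Set (lsuc ℓ)
  AclIsFieldAlgebraic T = ∀ K → K ⊨ᵀ T → (B : Pred ∣ K ∣ ℓ) →
    acl K B ≐ Ops.AlgebraicOver K B

  ----------------------------------------------------------------------
  -- Henselian valuations

  extend⁺ : {Γ : Set ℓ} → (Γ → Γ → Γ) → Γ ⁺ → Γ ⁺ → Γ ⁺
  extend⁺ _+_ [ α ] [ β ] = [ α + β ]
  extend⁺ _+_ [ α ] ⊤⁺    = ⊤⁺
  extend⁺ _+_ ⊤⁺    β     = ⊤⁺

  record Valuation (K : Structure L ℓ ℓ) : Set (lsuc ℓ) where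
    open Ops K
    field
      valueGroup : AbelianGroup ℓ ℓ

    open AbelianGroup valueGroup using () renaming (Carrier to Γ; _≈_ to _≈ᵍ_; _∙_ to _+ᵍ_; ε to 0ᵍ)

    field
      _≤ᵍ_         : Rel Γ ℓ
      isTotalOrder : IsTotalOrder _≈ᵍ_ _≤ᵍ_
      +ᵍ-mono      : ∀ {α β} γ → α ≤ᵍ β → (γ +ᵍ α) ≤ᵍ (γ +ᵍ β)
      v            : ∣ K ∣ → Γ ⁺

    open AddSupremum _≤ᵍ_ public using (_≤⁺_)
    open AddSupremumEq _≈ᵍ_ public using (_≈⁺_)

    _+⁺_ : Γ ⁺ → Γ ⁺ → Γ ⁺
    _+⁺_ = extend⁺ _+ᵍ_

    _<⁺_ : Γ ⁺ → Γ ⁺ → Set ℓ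
    α <⁺ β = (α ≤⁺ β) × ¬ (α ≈⁺ β)

    0⁺ : Γ ⁺
    0⁺ = [ 0ᵍ ]

    field
      v-cong        : ∀ {a b} → a ≈ b → v a ≈⁺ v b
      v-surjective  : ∀ γ → ∃[ a ] v a ≈⁺ [ γ ]
      v-∞           : ∀ a → (v a ≈⁺ ⊤⁺) ⇔ (a ≈ 0#)
      v-*           : ∀ a b → v (a * b) ≈⁺ (v a +⁺ v b)
      v-ultrametric : ∀ a b → (v a ≤⁺ v (a + b)) ⊎ (v b ≤⁺ v (a + b))

    ValuationOpen : Pred (Pred ∣ K ∣ ℓ) ℓ
    ValuationOpen U = ∀ a → a ∈ U → ∃[ γ ] ∀ y → [ γ ] <⁺ v (y - a) → y ∈ U

    IsHenselian : Set ℓ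
    IsHenselian = ∀ (q : Poly 1) → All (λ e → 0⁺ ≤⁺ v e) q → ∀ a → 0⁺ ≤⁺ v a →
      0⁺ <⁺ v (eval 1 q (a ∷ᵛ []ᵛ)) → v (eval 1 (∂ 1 zero q) (a ∷ᵛ []ᵛ)) ≈⁺ 0⁺ →
      ∃[ b ] eval 1 q (b ∷ᵛ []ᵛ) ≈ 0# × 0⁺ <⁺ v (b - a)

  -- The condition (†)_large.
  HasHenselianExtensions : Theory L ℓ → Formula L (suc m) → Set (lsuc ℓ)
  HasHenselianExtensions T χ = ∀ (K : Structure L ℓ ℓ) → K ⊨ᵀ T →
    Σ[ K′ ∈ Structure L ℓ ℓ ] (∃[ h ] IsElementaryEmbedding K K′ h) ×
    (Σ[ 𝓋 ∈ Valuation K′ ] Valuation.IsHenselian 𝓋 ×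
      (∀ U → Valuation.ValuationOpen 𝓋 U ⇔ DefinableOpen χ K′ U))

  ----------------------------------------------------------------------
  -- Generic derivations

  der : (K : Structure Lδ ℓ ℓ) → ∣ K ∣ → ∣ K ∣
  der K a = Structure.fun K (inj₂ δ) (a ∷ᵛ []ᵛ)

  record IsDerivation (K : Structure Lδ ℓ ℓ) : Set ℓ where
    open Ops (reduct K)
    field
      additive : ∀ a b → der K (a + b) ≈ der K a + der K b
      leibniz  : ∀ a b → der K (a * b) ≈ der K a * b + a * der K b

  jet : (K : Structure Lδ ℓ ℓ) → ∣ K ∣ → Vector ∣ K ∣ n
  jet K b i = iterate (der K) b (toℕ i)

  -- A differential polynomial q of order at most m is given by q* ∈ K[y₀,…,yₘ],
  -- so that q(b) is q* evaluated at the jet of b.  Its order is exactly m once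
  -- the separant does not vanish at some point.
  DL : Formula L (suc n) → Structure Lδ ℓ ℓ → Set (lsuc ℓ)
  DL χ K = ∀ m → 1 ℕ.≤ m → (q : Poly (suc m)) → let s = ∂ (suc m) (fromℕ m) q in
    (a : Vector Carrier (suc m)) → eval (suc m) q a ≈ 0# → ¬ (eval (suc m) s a ≈ 0#) →
    ∀ W → IsNbhd (Open^ (DefinableOpen χ (reduct K)) (suc m)) a W →
    ∃[ b ] eval (suc m) q (jet K b) ≈ 0# × ¬ (eval (suc m) s (jet K b) ≈ 0#) × jet K b ∈ W
    where open Ops (reduct K)

  -- The models of T*_δ.
  record ModelsT*δ (T : Theory L ℓ) (χ : Formula L (suc m)) (K : Structure Lδ ℓ ℓ) : Set (lsuc ℓ) where
    field
      modelsT      : reduct K ⊨ᵀ T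
      isDerivation : IsDerivation K
      dl           : DL χ K

  ----------------------------------------------------------------------
  -- The function p

  expandₚ : (K : Structure L ℓ ℓ) (f : Op₂ ∣ K ∣) → Congruent₂ (Structure._≈_ K) f →
            Structure Lₚ ℓ ℓ
  expandₚ K f f-cong = record
    { Carrier       = ∣ K ∣
    ; _≈_           = _≈_
    ; isEquivalence = isEquivalence
    ; fun           = fun′
    ; fun-cong      = fun′-cong
    ; rel           = rel
    ; rel-resp      = rel-resp
    }
    where
    open Structure K

    fun′ : Func Lₚ k → Vector ∣ K ∣ k → ∣ K ∣
    fun′ (inj₁ F) u = fun F u
    fun′ (inj₂ 𝓅) u = f (u zero) (u (suc zero))

    fun′-cong : (F : Func Lₚ k) {u v : Vector ∣ K ∣ k} →
                (∀ i → u i ≈ v i) → fun′ F u ≈ fun′ F v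
    fun′-cong (inj₁ F) h = fun-cong F h
    fun′-cong (inj₂ 𝓅) h = f-cong (h zero) (h (suc zero))

  -- f is the function p on the field K.
  IsP : (K : Structure L ℓ ℓ) → Op₂ ∣ K ∣ → Set ℓ
  IsP K f = ∀ a b → (b ≈ 0# → f a b ≈ a) × (¬ (b ≈ 0#) → f a b ≈ 0#)
    where open Ops K

  module _ {t : Level} {Mod : Pred (Structure L ℓ ℓ) t} {𝒜 : SubdirectProduct L ℓ}
           (isΓ : Γᵉ Mod 𝒜) where
    open SubdirectProduct 𝒜
    private
      isZero : Formula L 1
      isZero = var zero ≈′ fn zeroᶠ (λ ())

      module A = Ops structure

      zeroSet : A.Carrier → Pred Point ℓ
      zeroSet b = [[ isZero ]] (b ∷ᵛ []ᵛ)

      zeroSet-resp : ∀ {b b′} x → Agree b b′ x → x ∈ zeroSet b → x ∈ zeroSet b′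
      zeroSet-resp x e (lift z) = lift
        (S.trans (S.sym e) (S.trans z (S.fun-cong zeroᶠ (λ ()))))
        where module S = Structure (fibre x)

    -- p on 𝒜, obtained by patching a on [b = 0] with 0 on the complement; its
    -- values coincide coordinatewise with those of p on the fibres.
    pᴬ : A.Carrier → A.Carrier → A.Carrier
    pᴬ a b = proj₁ (Γᵉ.patchwork isΓ a A.0# (Γᵉ.clopen isΓ isZero (b ∷ᵛ []ᵛ)))

    private
      pᴬ-on : ∀ a b x → x ∈ zeroSet b → Agree a (pᴬ a b) x
      pᴬ-on a b x = proj₁ (proj₂ (Γᵉ.patchwork isΓ a A.0# (Γᵉ.clopen isΓ isZero (b ∷ᵛ []ᵛ))))

      pᴬ-off : ∀ a b x → ¬ (x ∈ zeroSet b) → Agree A.0# (pᴬ a b) x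
      pᴬ-off a b x = proj₂ (proj₂ (Γᵉ.patchwork isΓ a A.0# (Γᵉ.clopen isΓ isZero (b ∷ᵛ []ᵛ))))

    pᴬ-cong : ∀ {a a′ b b′} → a A.≈ a′ → b A.≈ b′ → pᴬ a b A.≈ pᴬ a′ b′
    pᴬ-cong {a} {a′} {b} {b′} e e′ x with proj₂ (proj₂ (Γᵉ.clopen isΓ isZero (b ∷ᵛ []ᵛ))) x
    ... | yes z = S.trans (S.sym (pᴬ-on a b x z))
                    (S.trans (e x) (pᴬ-on a′ b′ x (zeroSet-resp {b} {b′} x (e′ x) z)))
      where module S = Structure (fibre x)
    ... | no ¬z = S.trans (S.sym (pᴬ-off a b x ¬z))
                    (pᴬ-off a′ b′ x (λ z → ¬z (zeroSet-resp {b′} {b} x (S.sym (e′ x)) z)))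
      where module S = Structure (fibre x)

    structureₚ : Structure Lₚ ℓ ℓ
    structureₚ = expandₚ structure pᴬ pᴬ-cong

  -- χ is equivalent to the positive primitive formula χₚ, and on a Boolean
  -- product χₚ holds iff χ holds at every point.
  record IsLₚForm (T : Theory L ℓ) (χ : Formula L (suc m)) (χₚ : Formula Lₚ (suc m)) :
                  Set (lsuc (lsuc ℓ)) where
    field
      positivePrimitive : PositivePrimitive χₚ
      equivalent        : ∀ K → K ⊨ᵀ T → ∀ (f : Op₂ ∣ K ∣) (f-cong : Congruent₂ (Structure._≈_ K) f) →
        IsP K f → ∀ u → (K ⊨ χ [ u ]) ⇔ (expandₚ K f f-cong ⊨ χₚ [ u ])
      coordinatewise    : ∀ (𝒜 : SubdirectProduct L ℓ) (isΓ : Γᵉ (_⊨ᵀ T) 𝒜) →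
        let open SubdirectProduct 𝒜 in
        ∀ u → (structureₚ isΓ ⊨ χₚ [ u ]) ⇔ (∀ x → x ∈ [[ χ ]] u)

  ----------------------------------------------------------------------
  -- Dense pairs

  module _ (𝒜 : SubdirectProduct L ℓ) {D : Pred ∣ SubdirectProduct.structure 𝒜 ∣ ℓ}
           (sub : IsSubstructure (SubdirectProduct.structure 𝒜) D) where
    open SubdirectProduct 𝒜 renaming (structure to A)

    -- The domain of 𝒟ₓ.
    Image : ∀ x → Pred ∣ fibre x ∣ ℓ
    Image x a = ∃[ d ] d ∈ D × Structure._≈_ (fibre x) (proj₁ d x) a

    image-isSubstructure : ∀ x → IsSubstructure (fibre x) (Image x)
    image-isSubstructure x = record
      { resp   = λ e (d , d∈D , e′) → d , d∈D , S.trans e′ e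
      ; closed = λ F h → Structure.fun A F (λ i → proj₁ (h i))
                       , IsSubstructure.closed sub F (λ i → proj₁ (proj₂ (h i)))
                       , S.fun-cong F (λ i → proj₂ (proj₂ (h i)))
      }
      where module S = Structure (fibre x)

    fibreᴰ : Point → Structure L ℓ ℓ
    fibreᴰ x = substructure (image-isSubstructure x)

    [[_]]ᴰ : Formula L n → Vector (Σ ∣ A ∣ D) n → Pred Point ℓ
    [[ φ ]]ᴰ f x = fibreᴰ x ⊨ φ
      [ (λ i → proj₁ (proj₁ (f i)) x , proj₁ (f i) , proj₂ (f i) , Structure.refl (fibre x)) ]

    -- The domain of 𝒳(𝒟)* inside 𝒳(𝒜)*.
    Clopenᴰ : Pred ∣ clopenAlgebra space ∣ ℓ
    Clopenᴰ U = ∃[ n ] Σ[ φ ∈ Formula L n ] Σ[ f ∈ Vector (Σ ∣ A ∣ D) n ]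
      proj₁ U ≐ [[ φ ]]ᴰ f

    -- (𝒜, 𝒟) is a dense pair of models of Γᵉ_T̃(T).  Being a model in the case of
    -- 𝒟 is understood with respect to 𝒳(𝒟)*.
    record IsDensePair (T : Theory L ℓ) (T̃ : Theory LBA ℓ) (χₚ : Formula Lₚ (suc m)) :
                       Set (lsuc ℓ) where
      field
        isΓᴬ       : Γᵉ[ T̃ ] (_⊨ᵀ T) 𝒜
        modelsᴰ    : ∀ x → fibreᴰ x ⊨ᵀ T
        clopenᴰ    : ∀ {n} (φ : Formula L n) f → Clopen ([[ φ ]]ᴰ f)
        subalgebra : IsSubstructure (clopenAlgebra space) Clopenᴰ
        patchworkᴰ : ∀ f g → f ∈ D → g ∈ D → ∀ U → U ∈ Clopenᴰ →
                     ∃[ h ] h ∈ D × (proj₁ U ⊆ Agree f h) × (∁ (proj₁ U) ⊆ Agree g h)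
        algebraᴰ   : substructure subalgebra ⊨ᵀ T̃
        D1         : IsElementary subalgebra
        D2         : ∀ x → acl (fibre x) (Image x) ⊆ Image x

      private
        Aₚ : Structure Lₚ ℓ ℓ
        Aₚ = structureₚ (Γᵉ[_].isΓᵉ isΓᴬ)

      open Ops A

      field
        D3 : ∀ r (b : Vector Carrier m) → Aₚ ⊨ χₚ [ 0# ∷ᵛ b ] →
             ∃[ a ] (Aₚ ⊨ χₚ [ a ∷ᵛ b ]) × (r + a) ∈ D
        D4 : ∀ x (e : ∣ clopenAlgebra space ∣) → x ∈ proj₁ e → ∃[ ẽ ] ẽ ∈ Clopenᴰ × x ∈ proj₁ ẽ × proj₁ ẽ ⊆ proj₁ e

  constants : (𝒜 : SubdirectProduct Lδ ℓ) → Pred ∣ SubdirectProduct.structure 𝒜 ∣ ℓ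
  constants 𝒜 a = Structure._≈_ A (der A a) (Ops.0# (reduct A))
    where
    A : Structure Lδ ℓ ℓ
    A = SubdirectProduct.structure 𝒜

{-# OPTIONS --safe #-}
-- In a model K of T*_δ the constants C are relatively algebraically closed, and
-- dense by (DL) for δ(y).  A definable subset of K over C is finite, hence inside
-- acl(C) = C, or contains a nonempty open set, hence meets C; so C ≼ K by the
-- Tarski–Vaught test.
--
-- In a Boolean product 𝒜 compactness and patchwork glue solutions found in the
-- fibres.  This gives (D3), shows that the fibres of C_𝒜 are the constants of the
-- fibres, and that every clopen set is [ h = 1 ] for some constant h, so that
-- 𝒳(C_𝒜)* = 𝒳(𝒜)*.  As the truth of φ(f) in 𝒜 depends only on [ θ(f) ] for
-- finitely many θ, and any a ∈ A can be replaced by a constant with the same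
-- finitely many [ θ ] over given constants, Tarski–Vaught also yields C_𝒜 ≼ 𝒜.

module Submission where

open import Defs
open import Level using (Level; Lift; lift; lower) renaming (suc to lsuc)
open import Algebra.Bundles using (CommutativeRing)
import Algebra.Properties.Ring as RingProperties
import Algebra.Solver.Ring.NaturalCoefficients.Default as NaturalCoefficients
open import Data.Fin.Base using (Fin; zero; suc)
open import Data.List.Base using (List; []; _∷_; length; map; _++_; lookup; concat; tabulate)
open import Data.List.Membership.Propositional using () renaming (_∈_ to _∈ˡ_)
open import Data.List.Membership.Propositional.Properties using (∈-map⁺; ∈-++⁺ˡ; ∈-++⁺ʳ)
open import Data.List.Relation.Unary.All as All using (All; []; _∷_)
open import Data.List.Relation.Unary.All.Properties using (++⁻)
open import Data.List.Relation.Unary.Any as Any using (Any; here; there)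
import Data.List.Relation.Unary.Any.Properties as Anyₚ
open import Data.Nat.Base using (ℕ; zero; suc; z≤n; s≤s)
import Data.Nat.Properties as ℕₚ
open import Data.Product.Base using (Σ; Σ-syntax; ∃-syntax; _×_; _,_; proj₁; proj₂)
open import Data.Sum.Base using (_⊎_; inj₁; inj₂; [_,_]′)
open import Data.Vec.Functional as V using (Vector)
open import Function.Base using (_∘_; id)
open import Function.Bundles using (_⇔_; mk⇔; Equivalence)
open import Relation.Binary.Definitions using (_Respects_)
open import Relation.Binary.PropositionalEquality.Core as ≡ using (_≡_; cong)
import Relation.Binary.Reasoning.Setoid as SetoidReasoning
open import Relation.Nullary.Decidable.Core using (Dec; yes; no; map′)
open import Relation.Nullary.Negation.Core using (¬_; contradiction)
open import Relation.Unary using (Pred; _∈_; _⊆_; _≐_; _∩_; ∁)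

open Equivalence using (to; from)

private
  variable
    a c r l ℓ p t : Level
    m n : ℕ

decide : Classical → (P : Set a) → Dec P
decide em P = em {P = P}

-- Polynomials in one variable over a field

module Horner (R : CommutativeRing c ℓ) where
  open CommutativeRing R
  open RingProperties ring using (x+x≈x⇒x≈0)
  open NaturalCoefficients commutativeSemiring using (solve; _:=_; _:+_; _:*_; con)
  open SetoidReasoning setoid

  horner : List Carrier → Carrier → Carrier
  horner []       x = 0#
  horner (e ∷ es) x = e + x * horner es x

  Zero NonZero : Pred (List Carrier) _
  Zero    = All (_≈ 0#)
  NonZero = Any (λ e → ¬ (e ≈ 0#))

  horner-zero : ∀ {es} → Zero es → ∀ x → horner es x ≈ 0#
  horner-zero []       x = refl
  horner-zero {e ∷ es} (h ∷ hs) x = begin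
    e + x * horner es x ≈⟨ +-cong h (*-congˡ (horner-zero hs x)) ⟩
    0# + x * 0#         ≈⟨ trans (+-identityˡ _) (zeroʳ x) ⟩
    0#                  ∎

  constant-zero : ∀ {e es} x → horner (e ∷ es) x ≈ 0# → horner es x ≈ 0# → e ≈ 0#
  constant-zero {e} {es} x h h′ = begin
    e                   ≈⟨ sym (+-identityʳ e) ⟩
    e + 0#              ≈⟨ +-congˡ (sym (trans (*-congˡ h′) (zeroʳ x))) ⟩
    e + x * horner es x ≈⟨ h ⟩
    0#                  ∎

  -- The coefficients of the quotient of e ∷ es by y − x (they do not involve e).
  quotient : Carrier → List Carrier → List Carrier
  quotient x []       = []
  quotient x (e ∷ es) = horner (e ∷ es) x ∷ quotient x es

  quotient-length : ∀ x es → length (quotient x es) ≡ length es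
  quotient-length x []       = ≡.refl
  quotient-length x (e ∷ es) = cong suc (quotient-length x es)

  -- q(y) = q(x) + (y − x) q′(y) for q = e ∷ es and q′ = quotient x es, written
  -- without subtraction to be a semiring identity.
  quotient-spec : ∀ x y e es → let h = horner (quotient x es) y in
                  horner (e ∷ es) y + x * h ≈ horner (e ∷ es) x + y * h
  quotient-spec x y e []        =
    solve 3 (λ x y e →
      (e :+ y :* con 0) :+ x :* con 0 := (e :+ x :* con 0) :+ y :* con 0) refl x y e
  quotient-spec x y e (e′ ∷ es) = begin
    (e + y * Y) + x * (X + y * H)
      ≈⟨ solve 6 (λ x y e X Y H →
          (e :+ y :* Y) :+ x :* (X :+ y :* H) := (e :+ x :* X) :+ y :* (Y :+ x :* H))
          refl x y e X Y H ⟩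
    (e + x * X) + y * (Y + x * H)
      ≈⟨ +-congˡ (*-congˡ (quotient-spec x y e′ es)) ⟩
    (e + x * X) + y * (X + y * H) ∎
    where
    X = horner (e′ ∷ es) x
    Y = horner (e′ ∷ es) y
    H = horner (quotient x es) y

  -- The first entry of the quotient is the value of `e ∷ es` at `x`, which reduces to `e` once `es`
  -- vanishes. Together with `zero-tail`, this shows that a nonzero polynomial with a root has a
  -- nonzero quotient.
  quotient-zero : ∀ x es → Zero (quotient x es) → Zero es
  quotient-zero x []             _        = []
  quotient-zero x (e ∷ es) (h ∷ hs) =
    constant-zero {e} {es} x h (horner-zero zs x) ∷ zs
    where zs = quotient-zero x es hs

  numeral : ℕ → Carrier
  numeral zero    = 0#
  numeral (suc n) = 1# + numeral n

  -- The coefficients of y¹⁻ᵏ · d(yᵏ · es)/dy.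
  weigh : ℕ → List Carrier → List Carrier
  weigh k []       = []
  weigh k (e ∷ es) = numeral k * e ∷ weigh (suc k) es

  weigh-length : ∀ k es → length (weigh k es) ≡ length es
  weigh-length k []       = ≡.refl
  weigh-length k (e ∷ es) = cong suc (weigh-length (suc k) es)

  module Derivation (d : Carrier → Carrier)
    (d-cong : ∀ {x y} → x ≈ y → d x ≈ d y)
    (d-+ : ∀ x y → d (x + y) ≈ d x + d y)
    (d-* : ∀ x y → d (x * y) ≈ d x * y + x * d y) where

    d-0# : d 0# ≈ 0#
    d-0# = x+x≈x⇒x≈0 (d 0#) (trans (sym (d-+ 0# 0#)) (d-cong (+-identityˡ 0#)))

    d-1# : d 1# ≈ 0#
    d-1# = x+x≈x⇒x≈0 (d 1#) (begin
      d 1# + d 1#           ≈⟨ sym (+-cong (*-identityʳ _) (*-identityˡ _)) ⟩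
      d 1# * 1# + 1# * d 1# ≈⟨ sym (d-* 1# 1#) ⟩
      d (1# * 1#)           ≈⟨ d-cong (*-identityˡ 1#) ⟩
      d 1#                  ∎)

    d-neg : ∀ {x} → d x ≈ 0# → d (- x) ≈ 0#
    d-neg {x} h = begin
      d (- x)         ≈⟨ sym (+-identityˡ _) ⟩
      0# + d (- x)    ≈⟨ +-congʳ (sym h) ⟩
      d x + d (- x)   ≈⟨ sym (d-+ x (- x)) ⟩
      d (x + - x)     ≈⟨ d-cong (-‿inverseʳ x) ⟩
      d 0#            ≈⟨ d-0# ⟩
      0#              ∎

    -- Both sides stand for x¹⁻ᵏ · d(xᵏ · q(x)), with q given by `es`: the Leibniz rule on the left,
    -- termwise differentiation on the right. The exponent `k` is general because passing to the
    -- tail of `es` raises it by one.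
    d-horner : ∀ x k es → All (λ e → d e ≈ 0#) es →
      d (horner es x) * x + numeral k * horner es x * d x ≈ horner (weigh k es) x * d x
    d-horner x k []       []       = begin
      d 0# * x + numeral k * 0# * d x ≈⟨ +-congʳ (*-congʳ d-0#) ⟩
      0# * x + numeral k * 0# * d x   ≈⟨ solve 3 (λ x k dx →
          con 0 :* x :+ k :* con 0 :* dx := con 0 :* dx) refl x (numeral k) (d x) ⟩
      0# * d x                        ∎
    d-horner x k (e ∷ es) (h ∷ hs) = begin
      d (e + x * E) * x + K * (e + x * E) * d x
        ≈⟨ +-congʳ (*-congʳ (trans (d-+ _ _) (+-cong h (d-* x E)))) ⟩
      (0# + (d x * E + x * d E)) * x + K * (e + x * E) * d x
        ≈⟨ solve 6 (λ x e dx E dE K →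
            (con 0 :+ (dx :* E :+ x :* dE)) :* x :+ K :* (e :+ x :* E) :* dx :=
            K :* e :* dx :+ x :* (dE :* x :+ (con 1 :+ K) :* E :* dx))
            refl x e (d x) E (d E) K ⟩
      K * e * d x + x * (d E * x + (1# + K) * E * d x)
        ≈⟨ +-congˡ (*-congˡ (d-horner x (suc k) es hs)) ⟩
      K * e * d x + x * (W * d x)
        ≈⟨ solve 4 (λ x u W dx → u :* dx :+ x :* (W :* dx) := (u :+ x :* W) :* dx)
            refl x (K * e) W (d x) ⟩
      (K * e + x * W) * d x ∎
      where
      E = horner es x
      K = numeral k
      W = horner (weigh (suc k) es) x

    d-horner-∷ : ∀ x e es → All (λ e → d e ≈ 0#) (e ∷ es) →
      d (horner (e ∷ es) x) ≈ horner (weigh 1 es) x * d x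
    d-horner-∷ x e es (h ∷ hs) = begin
      d (e + x * E)               ≈⟨ trans (d-+ _ _) (+-cong h (d-* x E)) ⟩
      0# + (d x * E + x * d E)    ≈⟨ solve 4 (λ x dx E dE →
          con 0 :+ (dx :* E :+ x :* dE) := dE :* x :+ (con 1 :+ con 0) :* E :* dx)
          refl x (d x) E (d E) ⟩
      -- The constant term has dropped out, and x · `E` is the case of exponent 1; `numeral 1`
      -- unfolds to `1# + 0#`.
      d E * x + (1# + 0#) * E * d x ≈⟨ d-horner x 1 es hs ⟩
      horner (weigh 1 es) x * d x ∎
      where E = horner es x

    d-numeral : ∀ k → d (numeral k) ≈ 0#
    d-numeral zero    = d-0#
    d-numeral (suc k) = trans (d-+ _ _) (trans (+-cong d-1# (d-numeral k)) (+-identityˡ 0#))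

    d-*-zero : ∀ {x y} → d x ≈ 0# → d y ≈ 0# → d (x * y) ≈ 0#
    d-*-zero {x} {y} h h′ = begin
      d (x * y)           ≈⟨ d-* x y ⟩
      d x * y + x * d y   ≈⟨ +-cong (*-congʳ h) (*-congˡ h′) ⟩
      0# * y + x * 0#     ≈⟨ +-cong (zeroˡ y) (zeroʳ x) ⟩
      0# + 0#             ≈⟨ +-identityˡ 0# ⟩
      0#                  ∎

    weigh-constants : ∀ k es → All (λ e → d e ≈ 0#) es → All (λ e → d e ≈ 0#) (weigh k es)
    weigh-constants k []       []       = []
    weigh-constants k (e ∷ es) (h ∷ hs) = d-*-zero (d-numeral k) h ∷ weigh-constants (suc k) es hs

  module Field (em : Classical) (_⁻¹ : Carrier → Carrier)
    (inverse : ∀ x → ¬ (x ≈ 0#) → x * x ⁻¹ ≈ 1#) where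

    *-cancelʳ-nonzero : ∀ x y z → ¬ (z ≈ 0#) → x * z ≈ y * z → x ≈ y
    *-cancelʳ-nonzero x y z z≉0 h = begin
      x                ≈⟨ expand x ⟩
      x * z * z ⁻¹     ≈⟨ *-congʳ h ⟩
      y * z * z ⁻¹     ≈⟨ sym (expand y) ⟩
      y                ∎
      where
      expand : ∀ x → x ≈ x * z * z ⁻¹
      expand x = sym (trans (*-assoc x z _) (trans (*-congˡ (inverse z z≉0)) (*-identityʳ x)))

    *-zero-right : ∀ x y → ¬ (x ≈ 0#) → x * y ≈ 0# → y ≈ 0#
    *-zero-right x y x≉0 h =
      *-cancelʳ-nonzero y 0# x x≉0 (trans (*-comm y x) (trans h (sym (zeroˡ x))))

    ¬NonZero⇒Zero : ∀ {es} → ¬ NonZero es → Zero es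
    ¬NonZero⇒Zero {[]}     h = []
    ¬NonZero⇒Zero {e ∷ es} h with decide em (e ≈ 0#)
    ... | yes e≈0 = e≈0 ∷ ¬NonZero⇒Zero (h ∘ there)
    ... | no  e≉0 = contradiction (here e≉0) h

    Zero⇒¬NonZero : ∀ {es} → Zero es → ¬ NonZero es
    Zero⇒¬NonZero (h ∷ hs) (here e≉0) = e≉0 h
    Zero⇒¬NonZero (h ∷ hs) (there z)  = Zero⇒¬NonZero hs z

    zero-tail : ∀ {e es} x → horner (e ∷ es) x ≈ 0# → Zero es → ¬ NonZero (e ∷ es)
    zero-tail {e} {es} x h zs = Zero⇒¬NonZero (constant-zero {e} {es} x h (horner-zero zs x) ∷ zs)

    -- Divide by a root `x`: since (y - x) q′(y) = 0, a further root `y` is `x` itself or a root of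
    -- q′. The recursion is on the length `n`, as `quotient x es` is not a subterm of `e ∷ es`.
    finite-roots : ∀ n es → length es ≡ n → NonZero es →
      ∃[ xs ] ∀ y → horner es y ≈ 0# → Any (y ≈_) xs
    finite-roots zero    []       eq ()
    finite-roots (suc n) (e ∷ es) eq nz with decide em (∃[ x ] horner (e ∷ es) x ≈ 0#)
    ... | no  none     = [] , λ y h → contradiction (y , h) none
    ... | yes (x , hx) with decide em (NonZero (quotient x es))
    ...   | no z = contradiction nz (zero-tail x hx (quotient-zero x es (¬NonZero⇒Zero z)))
    ...   | yes nz′ with finite-roots n (quotient x es)
                           (≡.trans (quotient-length x es) (ℕₚ.suc-injective eq)) nz′
    ...     | xs , all = x ∷ xs , root
      where
      root : ∀ y → horner (e ∷ es) y ≈ 0# → Any (y ≈_) (x ∷ xs)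
      root y hy with decide em (horner (quotient x es) y ≈ 0#)
      ... | yes h = there (all y h)
      ... | no  h = here (sym (*-cancelʳ-nonzero x y (horner (quotient x es) y) h (begin
        x * H                      ≈⟨ sym (+-identityˡ _) ⟩
        0# + x * H                 ≈⟨ +-congʳ (sym hy) ⟩
        horner (e ∷ es) y + x * H  ≈⟨ quotient-spec x y e es ⟩
        horner (e ∷ es) x + y * H  ≈⟨ +-congʳ hx ⟩
        0# + y * H                 ≈⟨ +-identityˡ _ ⟩
        y * H                      ∎)))
        where H = horner (quotient x es) y

    -- The weights start at `suc k`, so none is `numeral 0`, and in characteristic 0 none of them
    -- vanishes: the derivative of a nonconstant polynomial is nonzero.
    weigh-nonzero : (∀ n → ¬ (numeral (suc n) ≈ 0#)) →
      ∀ k es → NonZero es → NonZero (weigh (suc k) es)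
    weigh-nonzero char0 k (e ∷ es) (here e≉0) = here (e≉0 ∘ *-zero-right _ _ (char0 k))
    weigh-nonzero char0 k (e ∷ es) (there nz) = there (weigh-nonzero char0 (suc k) es nz)

    module _ (char0 : ∀ n → ¬ (numeral (suc n) ≈ 0#)) (d : Carrier → Carrier)
      (d-cong : ∀ {x y} → x ≈ y → d x ≈ d y)
      (d-+ : ∀ x y → d (x + y) ≈ d x + d y)
      (d-* : ∀ x y → d (x * y) ≈ d x * y + x * d y) where
      open Derivation d d-cong d-+ d-*

      -- Applying d to q(x) = 0 gives q′(x) d(x) = 0; if q′(x) = 0, recurse on q′.
      algebraic⇒constant : ∀ n es → length es ≡ n → NonZero es → All (λ e → d e ≈ 0#) es →
        ∀ x → horner es x ≈ 0# → d x ≈ 0#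
      algebraic⇒constant zero    []       eq () hs x hx
      algebraic⇒constant (suc n) (e ∷ es) eq nz (h ∷ hs) x hx with decide em (NonZero es)
      ... | no z = contradiction nz (zero-tail x hx (¬NonZero⇒Zero z))
      ... | yes nz′ with decide em (horner (weigh 1 es) x ≈ 0#)
      ...   | yes w = algebraic⇒constant n (weigh 1 es)
                        (≡.trans (weigh-length 1 es) (ℕₚ.suc-injective eq))
                        (weigh-nonzero char0 0 es nz′) (weigh-constants 1 es hs) x w
      ...   | no  w = *-zero-right _ _ w
                        (trans (sym (d-horner-∷ x e es (h ∷ hs))) (trans (d-cong hx) d-0#))

      d-inverse : 0# ⁻¹ ≈ 0# → (∀ {x y} → x ≈ y → x ⁻¹ ≈ y ⁻¹) →
        ∀ {x} → d x ≈ 0# → d (x ⁻¹) ≈ 0#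
      d-inverse 0⁻¹≈0 ⁻¹-cong {x} h with decide em (x ≈ 0#)
      ... | yes x≈0 = trans (d-cong (trans (⁻¹-cong x≈0) 0⁻¹≈0)) d-0#
      ... | no  x≉0 = *-zero-right x (d (x ⁻¹)) x≉0 (begin
        x * d (x ⁻¹)                    ≈⟨ sym (+-identityˡ _) ⟩
        0# + x * d (x ⁻¹)               ≈⟨ +-congʳ (sym (trans (*-congʳ h) (zeroˡ _))) ⟩
        d x * x ⁻¹ + x * d (x ⁻¹)       ≈⟨ sym (d-* x (x ⁻¹)) ⟩
        d (x * x ⁻¹)                    ≈⟨ d-cong (inverse x x≉0) ⟩
        d 1#                            ≈⟨ d-1# ⟩
        0#                              ∎)

-- First-order logic

module _ {L : Language l} (K : Structure L c r) where
  open Structure K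

  ⟦⟧-cong : (t : Term L n) {u v : Vector Carrier n} → (∀ i → u i ≈ v i) → ⟦ K ⟧ t u ≈ ⟦ K ⟧ t v
  ⟦⟧-cong (var i)   h = h i
  ⟦⟧-cong (fn F ts) h = fun-cong F (λ i → ⟦⟧-cong (ts i) h)

  ∷-cong : ∀ {x} {u v : Vector Carrier n} → (∀ i → u i ≈ v i) → ∀ i → (x ∷ᵛ u) i ≈ (x ∷ᵛ v) i
  ∷-cong h zero    = refl
  ∷-cong h (suc i) = h i

  -- Valuations are functions and there is no function extensionality, so two presentations of one
  -- tuple agree only pointwise. Truth is carried between them by this lemma throughout.
  ⊨-resp : (φ : Formula L n) {u v : Vector Carrier n} → (∀ i → u i ≈ v i) →
           K ⊨ φ [ u ] → K ⊨ φ [ v ]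
  ⊨-resp (s ≈′ t)    h (lift e)  = lift (trans (sym (⟦⟧-cong s h)) (trans e (⟦⟧-cong t h)))
  ⊨-resp (rel′ R ts) h (lift x)  = lift (rel-resp R (λ i → ⟦⟧-cong (ts i) h) x)
  ⊨-resp (¬′ φ)      h x         = x ∘ ⊨-resp φ (sym ∘ h)
  ⊨-resp (φ ∧′ ψ)    h (x , y)   = ⊨-resp φ h x , ⊨-resp ψ h y
  ⊨-resp (φ ∨′ ψ)    h (inj₁ x)  = inj₁ (⊨-resp φ h x)
  ⊨-resp (φ ∨′ ψ)    h (inj₂ y)  = inj₂ (⊨-resp ψ h y)
  ⊨-resp (∃′ φ)      h (a , x)   = a , ⊨-resp φ (∷-cong h) x
  ⊨-resp (∀′ φ)      h x a       = ⊨-resp φ (∷-cong h) (x a)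

module _ {L : Language l} {F : ℕ → Set l} where

  liftᵗ : Term L n → Term (L ⊕ F) n
  liftᵗ (var i)   = var i
  liftᵗ (fn G ts) = fn (inj₁ G) (λ i → liftᵗ (ts i))

  liftᶠ : Formula L n → Formula (L ⊕ F) n
  liftᶠ (s ≈′ t)    = liftᵗ s ≈′ liftᵗ t
  liftᶠ (rel′ R ts) = rel′ R (λ i → liftᵗ (ts i))
  liftᶠ (¬′ φ)      = ¬′ liftᶠ φ
  liftᶠ (φ ∧′ ψ)    = liftᶠ φ ∧′ liftᶠ ψ
  liftᶠ (φ ∨′ ψ)    = liftᶠ φ ∨′ liftᶠ ψ
  liftᶠ (∃′ φ)      = ∃′ liftᶠ φ
  liftᶠ (∀′ φ)      = ∀′ liftᶠ φ

  module _ (K : Structure (L ⊕ F) c r) where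
    open Structure K

    liftᵗ-reduct : (t : Term L n) (v : Vector Carrier n) → ⟦ K ⟧ (liftᵗ t) v ≈ ⟦ reduct K ⟧ t v
    liftᵗ-reduct (var i)   v = refl
    liftᵗ-reduct (fn G ts) v = fun-cong (inj₁ G) (λ i → liftᵗ-reduct (ts i) v)

    -- This lets clopenness of truth sets pass from a Boolean product to its reduct.
    liftᶠ-reduct : (φ : Formula L n) (v : Vector Carrier n) →
                   (K ⊨ liftᶠ φ [ v ]) ⇔ (reduct K ⊨ φ [ v ])
    liftᶠ-reduct (s ≈′ t) v = mk⇔
      (λ (lift e) → lift (trans (sym (liftᵗ-reduct s v)) (trans e (liftᵗ-reduct t v))))
      (λ (lift e) → lift (trans (liftᵗ-reduct s v) (trans e (sym (liftᵗ-reduct t v)))))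
    liftᶠ-reduct (rel′ R ts) v = mk⇔
      (λ (lift x) → lift (rel-resp R (λ i → liftᵗ-reduct (ts i) v) x))
      (λ (lift x) → lift (rel-resp R (λ i → sym (liftᵗ-reduct (ts i) v)) x))
    liftᶠ-reduct (¬′ φ) v = mk⇔ (_∘ from (liftᶠ-reduct φ v)) (_∘ to (liftᶠ-reduct φ v))
    liftᶠ-reduct (φ ∧′ ψ) v = mk⇔
      (λ (x , y) → to (liftᶠ-reduct φ v) x , to (liftᶠ-reduct ψ v) y)
      (λ (x , y) → from (liftᶠ-reduct φ v) x , from (liftᶠ-reduct ψ v) y)
    liftᶠ-reduct (φ ∨′ ψ) v = mk⇔
      [ inj₁ ∘ to (liftᶠ-reduct φ v) , inj₂ ∘ to (liftᶠ-reduct ψ v) ]′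
      [ inj₁ ∘ from (liftᶠ-reduct φ v) , inj₂ ∘ from (liftᶠ-reduct ψ v) ]′
    liftᶠ-reduct (∃′ φ) v = mk⇔
      (λ (a , x) → a , to (liftᶠ-reduct φ (a ∷ᵛ v)) x)
      (λ (a , x) → a , from (liftᶠ-reduct φ (a ∷ᵛ v)) x)
    liftᶠ-reduct (∀′ φ) v = mk⇔
      (λ x a → to (liftᶠ-reduct φ (a ∷ᵛ v)) (x a))
      (λ x a → from (liftᶠ-reduct φ (a ∷ᵛ v)) (x a))

module _ {L : Language l} {K : Structure L c r} {P : Pred (Structure.Carrier K) p}
         (sub : IsSubstructure K P) where
  open Structure K

  ⟦⟧-closed : (t : Term L n) {v : Vector Carrier n} → (∀ i → v i ∈ P) → ⟦ K ⟧ t v ∈ P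
  ⟦⟧-closed (var i)   h = h i
  ⟦⟧-closed (fn F ts) h = IsSubstructure.closed sub F (λ i → ⟦⟧-closed (ts i) h)

  ⟦⟧-substructure : (t : Term L n) (v : Vector (Σ Carrier P) n) →
                    proj₁ (⟦ substructure sub ⟧ t v) ≈ ⟦ K ⟧ t (proj₁ ∘ v)
  ⟦⟧-substructure (var i)   v = refl
  ⟦⟧-substructure (fn F ts) v = fun-cong F (λ i → ⟦⟧-substructure (ts i) v)

  -- Induction on formulas; the test enters where a witness in `K` has to be replaced by one in `P`.
  -- For `∀′ φ` it is applied to `¬′ φ`: a counterexample in `K` would yield one in `P`.
  tarski-vaught : Classical →
    (∀ {n} (φ : Formula L (suc n)) (v : Vector Carrier n) → (∀ i → v i ∈ P) →
     ∀ a → K ⊨ φ [ a ∷ᵛ v ] → ∃[ b ] b ∈ P × K ⊨ φ [ b ∷ᵛ v ]) →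
    IsElementary sub
  tarski-vaught em test = go
    where
    swap : ∀ {n} (b : Σ Carrier P) (v : Vector (Σ Carrier P) n) →
           ∀ i → (proj₁ ∘ (b ∷ᵛ v)) i ≈ (proj₁ b ∷ᵛ (proj₁ ∘ v)) i
    swap b v zero    = refl
    swap b v (suc i) = refl

    go : IsElementary sub
    go (s ≈′ t) v = mk⇔
      (λ (lift e) → lift (trans (sym (⟦⟧-substructure s v)) (trans e (⟦⟧-substructure t v))))
      (λ (lift e) → lift (trans (⟦⟧-substructure s v) (trans e (sym (⟦⟧-substructure t v)))))
    go (rel′ R ts) v = mk⇔
      (λ (lift x) → lift (rel-resp R (λ i → ⟦⟧-substructure (ts i) v) x))
      (λ (lift x) → lift (rel-resp R (λ i → sym (⟦⟧-substructure (ts i) v)) x))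
    go (¬′ φ) v = mk⇔ (_∘ from (go φ v)) (_∘ to (go φ v))
    go (φ ∧′ ψ) v = mk⇔
      (λ (x , y) → to (go φ v) x , to (go ψ v) y)
      (λ (x , y) → from (go φ v) x , from (go ψ v) y)
    go (φ ∨′ ψ) v = mk⇔
      [ inj₁ ∘ to (go φ v) , inj₂ ∘ to (go ψ v) ]′
      [ inj₁ ∘ from (go φ v) , inj₂ ∘ from (go ψ v) ]′
    go (∃′ φ) v = mk⇔
      (λ (b , x) → proj₁ b , ⊨-resp K φ (swap b v) (to (go φ (b ∷ᵛ v)) x))
      λ (a , x) → let b , b∈P , y = test φ (proj₁ ∘ v) (proj₂ ∘ v) a x in
        (b , b∈P) , from (go φ ((b , b∈P) ∷ᵛ v)) (⊨-resp K φ (sym ∘ swap (b , b∈P) v) y)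
    go (∀′ φ) v = mk⇔ all
      (λ x b → from (go φ (b ∷ᵛ v)) (⊨-resp K φ (sym ∘ swap b v) (x (proj₁ b))))
      where
      all : substructure sub ⊨ ∀′ φ [ v ] → K ⊨ ∀′ φ [ proj₁ ∘ v ]
      all x a with decide em (K ⊨ φ [ a ∷ᵛ (proj₁ ∘ v) ])
      ... | yes y = y
      ... | no ¬y = let b , b∈P , z = test (¬′ φ) (proj₁ ∘ v) (proj₂ ∘ v) a ¬y in
        contradiction (⊨-resp K φ (swap (b , b∈P) v) (to (go φ ((b , b∈P) ∷ᵛ v)) (x (b , b∈P)))) z

-- Each v satisfies exactly one of the formulas in types Θ, which tells which
-- members of Θ it satisfies.
types : {L : Language l} → List (Formula L n) → List (Formula L n)
types []      = (∀′ (var zero ≈′ var zero)) ∷ []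
types (θ ∷ Θ) = map (θ ∧′_) (types Θ) ++ map ((¬′ θ) ∧′_) (types Θ)

type-of : Classical → {L : Language l} (K : Structure L c r) (Θ : List (Formula L n)) →
  ∀ u → ∃[ τ ] τ ∈ˡ types Θ × (K ⊨ τ [ u ]) ×
    (∀ v → K ⊨ τ [ v ] → All (λ θ → (K ⊨ θ [ u ]) ⇔ (K ⊨ θ [ v ])) Θ)
-- The empty conjunction is a quantified identity: it holds of every tuple and needs no free
-- variable, as `n` may be 0.
type-of em K []      u = _ , here ≡.refl , (λ a → lift (Structure.refl K)) , λ v _ → []
type-of em K (θ ∷ Θ) u with type-of em K Θ u | decide em (K ⊨ θ [ u ])
... | τ , τ∈ , x , h | yes y =
  θ ∧′ τ , ∈-++⁺ˡ (∈-map⁺ _ τ∈) , (y , x) ,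
  λ v (y′ , x′) → mk⇔ (λ _ → y′) (λ _ → y) ∷ h v x′
... | τ , τ∈ , x , h | no ¬y =
  (¬′ θ) ∧′ τ , ∈-++⁺ʳ _ (∈-map⁺ _ τ∈) , (¬y , x) ,
  λ v (¬y′ , x′) → mk⇔ (λ y → contradiction y ¬y) (λ y → contradiction y ¬y′) ∷ h v x′

-- Boolean products

module _ (X : BooleanSpace ℓ) where
  open BooleanSpace X
  open IsTopology isTopology using (ext)

  private
    variable
      U V : Pred Point ℓ

  clopen-resp : U ≐ V → Clopen U → Clopen V
  clopen-resp (f , g) (o , o′ , d) =
    ext (f , g) o , ext ((_∘ g) , (_∘ f)) o′ , λ x → map′ f g (d x)

  private
    algebra : (k : ℕ) → BAFunc k → Vector (Σ (Pred Point ℓ) Clopen) k → Σ (Pred Point ℓ) Clopen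
    algebra k F = Structure.fun (clopenAlgebra X) F

  clopen-∩ : Clopen U → Clopen V → Clopen (U ∩ V)
  clopen-∩ u v = proj₂ (algebra 2 meet ((_ , u) ∷ᵛ (_ , v) ∷ᵛ []ᵛ))

  clopen-∁ : Clopen U → Clopen (∁ U)
  clopen-∁ u = proj₂ (algebra 1 compl ((_ , u) ∷ᵛ []ᵛ))

  clopen-full : (∀ x → x ∈ U) → Clopen U
  clopen-full h = clopen-resp ((λ {x} _ → h x) , λ _ → lift zero) (proj₂ (algebra 0 top []ᵛ))

  clopen-⇒ : Clopen U → Clopen V → Clopen (λ x → U x → V x)
  clopen-⇒ {U} {V} u v@(_ , _ , d) =
    clopen-resp (to′ , λ h (x , ¬y) → ¬y (h x)) (clopen-∁ (clopen-∩ u (clopen-∁ v)))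
    where
    to′ : ∀ {x} → ¬ (U x × ¬ V x) → U x → V x
    to′ {x} h y with d x
    ... | yes z = z
    ... | no ¬z = contradiction (y , ¬z) h

  clopen-⇔ : Clopen U → Clopen V → Clopen (λ x → U x ⇔ V x)
  clopen-⇔ u v = clopen-resp ((λ (f , g) → mk⇔ f g) , λ e → to e , from e)
    (clopen-∩ (clopen-⇒ u v) (clopen-⇒ v u))

  clopen-All : {A : Set ℓ} {P : A → Pred Point ℓ} → (∀ y → Clopen (P y)) →
               ∀ ys → Clopen (λ x → All (λ y → P y x) ys)
  clopen-All h []       = clopen-full (λ _ → [])
  clopen-All h (y ∷ ys) = clopen-resp ((λ (p , ps) → p ∷ ps) , λ { (p ∷ ps) → p , ps })
    (clopen-∩ (h y) (clopen-All h ys))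

module BooleanProduct {L : Language ℓ} {Mod : Pred (Structure L ℓ ℓ) t} (em : Classical)
  (𝒜 : SubdirectProduct L ℓ) (isΓ : Γᵉ Mod 𝒜) where
  open SubdirectProduct 𝒜 renaming (structure to A)
  open Structure A using (Carrier)
  open Γᵉ isΓ

  at : Vector Carrier n → ∀ x → Vector (Structure.Carrier (fibre x)) n
  at f x i = proj₁ (f i) x

  at-∷ : ∀ a (f : Vector Carrier n) x i →
         Structure._≈_ (fibre x) (at (a ∷ᵛ f) x i) ((proj₁ a x ∷ᵛ at f x) i)
  at-∷ a f x zero    = Structure.refl (fibre x)
  at-∷ a f x (suc i) = Structure.refl (fibre x)

  -- Whether `x` lies in `S f` depends only on the value of `f` at `x`, so a patched section
  -- inherits membership from whichever section it copies there. One implication suffices, since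
  -- `Agree` is symmetric.
  Local : (Carrier → Pred Point ℓ) → Set ℓ
  Local S = ∀ f g x → x ∈ Agree f g → x ∈ S f → x ∈ S g

  -- The maximum principle: local solutions are patched along a finite clopen cover.
  patch-solutions : Carrier → (S : Carrier → Pred Point ℓ) → (∀ f → Clopen (S f)) → Local S →
    (∀ x → ∃[ f ] x ∈ S f) → ∃[ f ] ∀ x → x ∈ S f
  patch-solutions default S S-clopen local solve =
    let fs , cover = compact S (λ f → proj₁ (S-clopen f)) solve
        h , hS     = go fs
    in h , λ x → hS x (cover x)
    where
    go : ∀ fs → ∃[ h ] ∀ x → Any (λ f → x ∈ S f) fs → x ∈ S h
    -- No point is covered yet, so any section serves; `default` supplies one even when the space is
    -- empty.
    go []       = default , λ x ()
    go (f ∷ fs) with go fs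
    -- The new section takes precedence on its own clopen set and leaves `h` in force off it.
    ... | h , hS with patchwork f h (S-clopen f)
    ...   | g , on , off = g , solves
      where
      solves : ∀ x → Any (λ f → x ∈ S f) (f ∷ fs) → x ∈ S g
      solves x any with proj₂ (proj₂ (S-clopen f)) x | any
      ... | yes s | _       = local f g x (on s) s
      ... | no ¬s | here s  = contradiction s ¬s
      ... | no ¬s | there t = local h g x (off ¬s) (hS x t)

  SameType : List (Formula L n) → Vector Carrier n → Vector Carrier n → Pred Point ℓ
  SameType Θ u v x = All (λ θ → ([[ θ ]] u x) ⇔ ([[ θ ]] v x)) Θ

  -- The maximum principle for `S` together with agreement on `Θ`, a clopen condition because `Θ` is
  -- finite. In each fibre one formula of `types Θ` isolates the type of `a` over `f`, so it is
  -- enough to realize such formulas. The side condition `S` is trivial in `extend-type` and is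
  -- constancy in `C-elementary`.
  realize-types : (S : Carrier → Pred Point ℓ) → (∀ f → Clopen (S f)) → Local S →
    (Θ : List (Formula L (suc n))) (a : Carrier) (f g : Vector Carrier n) →
    (∀ x τ → τ ∈ˡ types Θ → fibre x ⊨ τ [ proj₁ a x ∷ᵛ at f x ] →
       ∃[ b ] x ∈ S b × fibre x ⊨ τ [ proj₁ b x ∷ᵛ at g x ]) →
    ∃[ b ] (∀ x → x ∈ S b) × (∀ x → x ∈ SameType Θ (a ∷ᵛ f) (b ∷ᵛ g))
  realize-types S S-clopen S-local Θ a f g realized =
    let b , h = patch-solutions a S′ S′-clopen S′-local solve in
    b , (λ x → proj₁ (h x)) , (λ x → proj₂ (h x))
    where
    S′ : Carrier → Pred Point ℓ
    S′ b = S b ∩ SameType Θ (a ∷ᵛ f) (b ∷ᵛ g)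

    S′-clopen : ∀ b → Clopen (S′ b)
    S′-clopen b = clopen-∩ space (S-clopen b)
      (clopen-All space (λ θ → clopen-⇔ space (clopen θ (a ∷ᵛ f)) (clopen θ (b ∷ᵛ g))) Θ)

    S′-local : Local S′
    S′-local b b′ x e (s , same) = S-local b b′ x e s , All.map (λ {θ} → step θ) same
      where
      module K = Structure (fibre x)
      agree : ∀ i → at (b ∷ᵛ g) x i K.≈ at (b′ ∷ᵛ g) x i
      agree zero    = e
      agree (suc i) = K.refl
      step : ∀ θ → _ ⇔ ([[ θ ]] (b ∷ᵛ g) x) → _ ⇔ ([[ θ ]] (b′ ∷ᵛ g) x)
      step θ eq = mk⇔ (⊨-resp (fibre x) θ agree ∘ to eq)
                      (from eq ∘ ⊨-resp (fibre x) θ (K.sym ∘ agree))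

    solve : ∀ x → ∃[ b ] x ∈ S′ b
    solve x with type-of em (fibre x) Θ (at (a ∷ᵛ f) x)
    ... | τ , τ∈ , t , determines with realized x τ τ∈ (⊨-resp (fibre x) τ (at-∷ a f x) t)
    ...   | b , s , t′ = b , s ,
      determines _ (⊨-resp (fibre x) τ (λ i → Structure.sym (fibre x) (at-∷ b g x i)) t′)

  -- The forth step of a back-and-forth: agreement on `∃′ τ` for all possible types `τ` says that in
  -- each fibre the same types of one more element are realized over `f` and over `g`.
  extend-type : (Θ : List (Formula L (suc n))) (f g : Vector Carrier n) →
    (∀ x → x ∈ SameType (map ∃′_ (types Θ)) f g) →
    ∀ a → ∃[ b ] ∀ x → x ∈ SameType Θ (a ∷ᵛ f) (b ∷ᵛ g)
  extend-type Θ f g same a =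
    let b , _ , h = realize-types (λ _ _ → Lift ℓ (Fin 1))
                      (λ _ → clopen-full space (λ _ → lift zero))
                      (λ _ _ _ _ s → s) Θ a f g realized
    in b , h
    where
    realized : ∀ x τ → τ ∈ˡ types Θ → fibre x ⊨ τ [ proj₁ a x ∷ᵛ at f x ] →
               ∃[ b ] Lift ℓ (Fin 1) × fibre x ⊨ τ [ proj₁ b x ∷ᵛ at g x ]
    realized x τ τ∈ t with to (All.lookup (same x) (∈-map⁺ ∃′_ τ∈)) (proj₁ a x , t)
    ... | b₀ , t′ with projects x b₀
    ...   | b , el , e = (b , el) , lift zero , ⊨-resp (fibre x) τ agree t′
      where
      agree : ∀ i → Structure._≈_ (fibre x) ((b₀ ∷ᵛ at g x) i) ((b x ∷ᵛ at g x) i)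
      agree zero    = Structure.sym (fibre x) e
      agree (suc i) = Structure.refl (fibre x)

  ⟦⟧-at : (t : Term L n) (f : Vector Carrier n) → ∀ x →
          Structure._≈_ (fibre x) (proj₁ (⟦ A ⟧ t f) x) (⟦ fibre x ⟧ t (at f x))
  ⟦⟧-at (var i)   f x = Structure.refl (fibre x)
  ⟦⟧-at (fn F ts) f x = Structure.fun-cong (fibre x) F (λ i → ⟦⟧-at (ts i) f x)

  ≈′-pointwise : (s t : Term L n) (f : Vector Carrier n) →
                 (A ⊨ s ≈′ t [ f ]) ⇔ (∀ x → x ∈ [[ s ≈′ t ]] f)
  ≈′-pointwise s t f = mk⇔
    (λ (lift e) x → let open Structure (fibre x) in
      lift (trans (sym (⟦⟧-at s f x)) (trans (e x) (⟦⟧-at t f x))))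
    (λ h → lift (λ x → let open Structure (fibre x) in
      trans (⟦⟧-at s f x) (trans (lower (h x)) (sym (⟦⟧-at t f x)))))

  rel′-pointwise : ∀ {k} (R : Language.Rel′ L k) (ts : Fin k → Term L n) (f : Vector Carrier n) →
                   (A ⊨ rel′ R ts [ f ]) ⇔ (∀ x → x ∈ [[ rel′ R ts ]] f)
  rel′-pointwise R ts f = mk⇔
    (λ (lift e) x → lift (Structure.rel-resp (fibre x) R (λ i → ⟦⟧-at (ts i) f x) (e x)))
    (λ h → lift (λ x → Structure.rel-resp (fibre x) R
      (λ i → Structure.sym (fibre x) (⟦⟧-at (ts i) f x)) (lower (h x))))

  sameType-sym : ∀ {Θ : List (Formula L n)} f g {x} → x ∈ SameType Θ f g → x ∈ SameType Θ g f
  sameType-sym f g = All.map (λ e → mk⇔ (from e) (to e))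

  -- A weak form of the Feferman–Vaught theorem: the truth of φ in 𝒜 depends only
  -- on finitely many of the clopen sets [ θ ].
  determinants : Formula L n → List (Formula L n)
  determinants (s ≈′ t)    = (s ≈′ t) ∷ []
  determinants (rel′ R ts) = rel′ R ts ∷ []
  determinants (¬′ φ)      = determinants φ
  determinants (φ ∧′ ψ)    = determinants φ ++ determinants ψ
  determinants (φ ∨′ ψ)    = determinants φ ++ determinants ψ
  determinants (∃′ φ)      = map ∃′_ (types (determinants φ))
  determinants (∀′ φ)      = map ∃′_ (types (determinants φ))

  determined : (φ : Formula L n) {f g : Vector Carrier n} →
    (∀ x → x ∈ SameType (determinants φ) f g) → A ⊨ φ [ f ] → A ⊨ φ [ g ]
  determined (s ≈′ t) {f} {g} same y =
    from (≈′-pointwise s t g) (λ x → to (All.head (same x)) (to (≈′-pointwise s t f) y x))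
  determined (rel′ R ts) {f} {g} same y =
    from (rel′-pointwise R ts g) (λ x → to (All.head (same x)) (to (rel′-pointwise R ts f) y x))
  determined (¬′ φ) {f} {g} same y = y ∘ determined φ (λ x → sameType-sym f g (same x))
  determined (φ ∧′ ψ) same (y , z) =
    determined φ (λ x → proj₁ (++⁻ (determinants φ) (same x))) y ,
    determined ψ (λ x → proj₂ (++⁻ (determinants φ) (same x))) z
  determined (φ ∨′ ψ) same (inj₁ y) =
    inj₁ (determined φ (λ x → proj₁ (++⁻ (determinants φ) (same x))) y)
  determined (φ ∨′ ψ) same (inj₂ z) =
    inj₂ (determined ψ (λ x → proj₂ (++⁻ (determinants φ) (same x))) z)
  determined (∃′ φ) {f} {g} same (a , y) =
    let b , h = extend-type (determinants φ) f g same a in b , determined φ h y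
  -- Here the extension runs backwards: an arbitrary `b` over `g` is matched with some `a` over `f`,
  -- to which `y` applies. Hence existential determinants serve for `∀′` too.
  determined (∀′ φ) {f} {g} same y b =
    let a , h = extend-type (determinants φ) g f (λ x → sameType-sym f g (same x)) b in
    determined φ (λ x → sameType-sym (b ∷ᵛ g) (a ∷ᵛ f) (h x)) (y a)

-- Fields with a generic derivation

module GenericDerivation (em : Classical) {ℓ : Level} {Const : Set ℓ} {R : ℕ → Set ℓ} {m : ℕ}
  {T : Theory (FieldLanguage Const R) ℓ} {χ : Formula (FieldLanguage Const R) (suc m)}
  (openT : IsOpenTheory T χ) (aclT : AclIsFieldAlgebraic T)
  (K : Structure (FieldLanguageδ Const R) ℓ ℓ) (modK : ModelsT*δ T χ K)
  (const-constant : ∀ κ → Structure._≈_ K (der K (Structure.fun K (inj₁ (const κ)) []ᵛ))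
                                          (Ops.0# (reduct K)))
  where
  open ModelsT*δ modK
  open IsDerivation isDerivation

  K₀ : Structure (FieldLanguage Const R) ℓ ℓ
  K₀ = reduct K

  private
    module O = IsOpenTheory openT
    module F = IsFieldOfChar0 (O.fields K₀ modelsT)

  commutativeRing : CommutativeRing ℓ ℓ
  commutativeRing = record { isCommutativeRing = F.isCommutativeRing }

  open Ops K₀ using (Carrier; Poly; eval; Definable; ZariskiClosed; Generated; _⁻¹; fun; fun-cong)
  open CommutativeRing commutativeRing hiding (Carrier; zero)
  open RingProperties ring using (-‿+-comm; -‿involutive)
  open NaturalCoefficients commutativeSemiring using (solve; _:=_; _:+_; _:*_; con)
  open SetoidReasoning setoid
  open Horner commutativeRing using (horner; NonZero; horner-zero; module Derivation; module Field)

  Opens : Pred (Pred Carrier ℓ) ℓ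
  Opens = DefinableOpen χ K₀

  private
    module Top = IsTopology (IsFieldTopology.isTopology (O.fieldTopology K₀ modelsT))
    open Field em _⁻¹ F.inverse using (finite-roots; algebraic⇒constant; d-inverse; ¬NonZero⇒Zero)

    pair-cong : ∀ {x x′ y y′} → x ≈ x′ → y ≈ y′ → ∀ i → (x ∷ᵛ y ∷ᵛ []ᵛ) i ≈ (x′ ∷ᵛ y′ ∷ᵛ []ᵛ) i
    pair-cong e e′ zero       = e
    pair-cong e e′ (suc zero) = e′

    single-cong : ∀ {x x′} → x ≈ x′ → ∀ i → (x ∷ᵛ []ᵛ) i ≈ (x′ ∷ᵛ []ᵛ) i
    single-cong e zero = e

  d : Carrier → Carrier
  d = der K

  d-cong : ∀ {x y} → x ≈ y → d x ≈ d y
  d-cong e = Structure.fun-cong K (inj₂ δ) (single-cong e)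

  open Derivation d d-cong additive leibniz using (d-0#; d-1#; d-neg; d-*-zero)

  numeral-horner : ∀ n → Ops.numeral K₀ n ≡ Horner.numeral commutativeRing n
  numeral-horner zero    = ≡.refl
  numeral-horner (suc n) = cong (1# +_) (numeral-horner n)

  char0 : ∀ n → ¬ (Horner.numeral commutativeRing (suc n) ≈ 0#)
  char0 n = ≡.subst (λ x → ¬ (x ≈ 0#)) (numeral-horner (suc n)) (F.char0 n)

  eval-horner : ∀ q v → eval 1 q v ≈ horner q (v zero)
  eval-horner []      v = refl
  eval-horner (e ∷ q) v = +-congˡ (*-congˡ (eval-horner q v))

  Constant : Pred Carrier ℓ
  Constant x = d x ≈ 0#

  constant-resp : Constant Respects _≈_
  constant-resp e h = trans (d-cong (sym e)) h

  constant-fun : ∀ {k} (F : FieldFunc Const k) {v : Vector Carrier k} →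
                 (∀ i → Constant (v i)) → Constant (fun F v)
  constant-fun zeroᶠ     h = constant-resp (fun-cong zeroᶠ (λ ())) d-0#
  constant-fun oneᶠ      h = constant-resp (fun-cong oneᶠ (λ ())) d-1#
  constant-fun negᶠ {v}  h = constant-resp {x = - v zero}
    (fun-cong negᶠ λ { zero → refl }) (d-neg (h zero))
  constant-fun invᶠ {v}  h = constant-resp {x = v zero ⁻¹}
    (fun-cong invᶠ λ { zero → refl })
    (d-inverse char0 d d-cong additive leibniz F.0⁻¹≈0
      (λ e → fun-cong invᶠ (single-cong e)) (h zero))
  constant-fun addᶠ {v}  h = constant-resp {x = v zero + v (suc zero)}
    (fun-cong addᶠ λ { zero → refl ; (suc zero) → refl })
    (trans (additive _ _) (trans (+-cong (h zero) (h (suc zero))) (+-identityˡ 0#)))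
  constant-fun mulᶠ {v}  h = constant-resp {x = v zero * v (suc zero)}
    (fun-cong mulᶠ λ { zero → refl ; (suc zero) → refl }) (d-*-zero (h zero) (h (suc zero)))
  constant-fun (const κ) h = constant-resp (fun-cong (const κ) (λ ())) (const-constant κ)

  constants-substructure : IsSubstructure K₀ Constant
  constants-substructure = record { resp = constant-resp ; closed = constant-fun }

  -- By `aclT` such an element is a root of a nonzero polynomial over the field generated by `B` and
  -- the constant symbols. That field consists of constants, because these form a substructure, so
  -- `algebraic⇒constant` applies.
  acl⊆constants : (B : Pred Carrier ℓ) → B ⊆ Constant → acl K₀ B ⊆ Constant
  acl⊆constants B B⊆C {x} x∈acl =
    let q , gen , nz , q[x]≈0 = proj₁ (aclT K₀ modelsT B) x∈acl in
    algebraic⇒constant char0 d d-cong additive leibniz (length q) q ≡.refl nz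
      (All.map generated gen) x (trans (sym (eval-horner q (x ∷ᵛ []ᵛ))) q[x]≈0)
    where
    generated : Generated B ⊆ Constant
    generated (_ , t , b , b∈B , e) =
      constant-resp (sym e) (⟦⟧-closed constants-substructure t (λ i → B⊆C (b∈B i)))

  -- (DL) for the differential polynomial δ(y), that is y₁.
  constants-dense : ∀ {U} → Opens U → ∀ x → x ∈ U → ∃[ c ] Constant c × c ∈ U
  constants-dense {U} U-open x x∈U =
    -- The zero of y₁ at which (DL) is applied; the separant is 1, and the neighbourhood restricts
    -- the first coordinate only.
    let v = x ∷ᵛ 0# ∷ᵛ []ᵛ
        c , q≈0 , _ , c∈U = dl 1 (s≤s z≤n) q v (q-eval v)
          (λ s≈0 → F.0≉1 (trans (sym s≈0) (s-eval v)))
          (λ w → w zero ∈ U) ((λ w → w zero ∈ U) , W-open , x∈U , id)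
    in c , trans (sym (q-eval (jet K c))) q≈0 , c∈U
    where
    q : Poly 2
    -- As a polynomial in y₀ this has a single coefficient, namely 0 + 1 · y₁.
    q = (0# ∷ 1# ∷ []) ∷ []

    q-eval : ∀ v → eval 2 q v ≈ v (suc zero)
    q-eval v = solve 2 (λ x y → (con 0 :+ y :* (con 1 :+ y :* con 0)) :+ x :* con 0 := y) refl
      (v zero) (v (suc zero))

    s-eval : ∀ v → eval 2 (Ops.∂ K₀ 2 (suc zero) q) v ≈ 1#
    s-eval v = solve 2 (λ x y →
      ((con 1 :+ con 0) :+ y :* (con 0 :+ y :* con 0)) :+ x :* con 0 := con 1) refl
      (v zero) (v (suc zero))

    W-open : Open^ Opens 2 (λ w → w zero ∈ U)
    W-open v v∈W = U′ , U′-open , U′-in , λ w h → h zero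
      where
      U′ : Fin 2 → Pred Carrier ℓ
      U′ zero    = U
      U′ (suc _) = λ _ → Lift ℓ (Fin 1)
      U′-open : ∀ i → Opens (U′ i)
      U′-open zero    = U-open
      U′-open (suc _) = Top.full (λ _ → lift zero)
      U′-in : ∀ i → v i ∈ U′ i
      U′-in zero    = v∈W
      U′-in (suc _) = lift zero

  translate-open : ∀ {U} → Opens U → ∀ r → Opens (λ y → y - r ∈ U)
  translate-open {U} U-open r a a-r∈U =
    let b , χ0 , ball = U-open (a - r) a-r∈U in
    b , χ0 , λ y h → ball (y - r) (⊨-resp K₀ χ (λ { zero → cancel y ; (suc i) → refl }) h)
    where
    cancel : ∀ y → y - a ≈ (y - r) - (a - r)
    cancel y = sym (begin
      (y - r) + - (a + - r)    ≈⟨ +-congˡ (sym (-‿+-comm a (- r))) ⟩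
      (y - r) + (- a + - - r)  ≈⟨ +-congˡ (+-congˡ (-‿involutive r)) ⟩
      (y + - r) + (- a + r)    ≈⟨ solve 4 (λ y r′ a′ r →
                                    (y :+ r′) :+ (a′ :+ r) := (y :+ a′) :+ (r :+ r′))
                                    refl y (- r) (- a) r ⟩
      (y - a) + (r + - r)      ≈⟨ +-congˡ (-‿inverseʳ r) ⟩
      (y - a) + 0#             ≈⟨ +-identityʳ _ ⟩
      y - a                    ∎)

  add-minus : ∀ r f → r + (f - r) ≈ f
  add-minus r f = begin
    r + (f + - r) ≈⟨ solve 3 (λ r f r′ → r :+ (f :+ r′) := f :+ (r :+ r′)) refl r f (- r) ⟩
    f + (r + - r) ≈⟨ +-congˡ (-‿inverseʳ r) ⟩
    f + 0#        ≈⟨ +-identityʳ f ⟩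
    f             ∎

  -- The set χ(K,b) contains an open `U` around 0, and the translate of `U` by `r` is open around
  -- `r`, so a constant falls into it. This is (D3) in a single fibre.
  constant-in-ball : ∀ r b → K₀ ⊨ χ [ 0# ∷ᵛ b ] → ∃[ c ] Constant c × K₀ ⊨ χ [ (c - r) ∷ᵛ b ]
  constant-in-ball r b χ0 =
    let U , U-open , 0∈U , U⊆ = proj₁ (O.basis K₀ modelsT) b χ0
        c , c-const , c-r∈U   = constants-dense (translate-open U-open r) r
                                  (Top.resp U-open (sym (-‿inverseʳ r)) 0∈U)
    in c , c-const , U⊆ c-r∈U

  -- Either all polynomials defining `Z` are zero, or a single nonzero one already confines `Z` to
  -- its finitely many roots.
  zariski-closed-line : (Z : Pred (Vector Carrier 1) ℓ) → ZariskiClosed Z →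
    (∀ v → v ∈ Z) ⊎ (∃[ xs ] ∀ v → v ∈ Z → Any (v zero ≈_) xs)
  zariski-closed-line Z (I , q , Z⊆ , ⊆Z) with decide em (∃[ i ] NonZero (q i))
  ... | yes (i , nz) =
    let xs , roots = finite-roots (length (q i)) (q i) ≡.refl nz in
    inj₂ (xs , λ v v∈Z → roots (v zero) (trans (sym (eval-horner (q i) v)) (Z⊆ v∈Z i)))
  ... | no none = inj₁ (λ v → ⊆Z (λ i →
    trans (eval-horner (q i) v) (horner-zero (¬NonZero⇒Zero (λ nz → none (i , nz))) (v zero))))

  -- The solution set is a finite union of sets Z ∩ U. If some Z is the whole line and its U is
  -- nonempty, density puts a constant into that U. Otherwise every piece is finite, so `a` is
  -- algebraic over the constants and is itself one.
  constant-witness : (φ : Formula (FieldLanguage Const R) (suc n)) (v : Vector Carrier n) →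
    (∀ i → Constant (v i)) → ∀ a → K₀ ⊨ φ [ a ∷ᵛ v ] → ∃[ b ] Constant b × K₀ ⊨ φ [ b ∷ᵛ v ]
  constant-witness {n} φ v v-const a φ[a] =
    let k , Z , U , parts , S⊆ , ⊆S = O.definableSets K₀ modelsT S S-definable in
    cases k Z U parts S⊆ ⊆S
    where
    S : Pred (Vector Carrier 1) ℓ
    S w = K₀ ⊨ φ [ w zero ∷ᵛ v ]

    S-definable : Definable S
    S-definable = n , φ , v ,
      (λ {w} → ⊨-resp K₀ φ (λ i → sym (split w i))) , (λ {w} → ⊨-resp K₀ φ (split w))
      where
      split : ∀ w i → (w V.++ v) i ≈ (w zero ∷ᵛ v) i
      split w zero    = refl
      split w (suc i) = refl

    cases : ∀ k (Z U : Fin k → Pred (Vector Carrier 1) ℓ) →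
      (∀ i → ZariskiClosed (Z i) × Definable (U i) × Open^ Opens 1 (U i)) →
      (∀ {w} → w ∈ S → ∃[ i ] w ∈ Z i × w ∈ U i) →
      (∀ {w} → ∃[ i ] w ∈ Z i × w ∈ U i → w ∈ S) →
      ∃[ b ] Constant b × K₀ ⊨ φ [ b ∷ᵛ v ]
    cases k Z U parts S⊆ ⊆S with decide em (∃[ i ] (∀ w → w ∈ Z i) × ∃[ w ] w ∈ U i)
    ... | yes (i , full , w , w∈U) =
      let U₀ , U₀-open , w∈U₀ , U₀⊆ = proj₂ (proj₂ (parts i)) w w∈U
          c , c-const , c∈U₀         = constants-dense (U₀-open zero) (w zero) (w∈U₀ zero)
      in c , c-const , ⊆S (i , full (c ∷ᵛ []ᵛ) , U₀⊆ (c ∷ᵛ []ᵛ) (λ { zero → c∈U₀ }))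
    ... | no none = a , acl⊆constants Constant id a∈acl , φ[a]
      where
      finite : ∀ i → ∃[ xs ] ∀ w → w ∈ Z i → w ∈ U i → Any (w zero ≈_) xs
      finite i with zariski-closed-line (Z i) (proj₁ (parts i))
      -- A piece over the whole line is empty here: a point of `U i` would bring back the excluded
      -- case.
      ... | inj₁ full        = [] , λ w _ w∈U → contradiction (i , full , w , w∈U) none
      ... | inj₂ (xs , roots) = xs , λ w w∈Z _ → roots w w∈Z

      solutions : List Carrier
      solutions = concat (tabulate (λ i → proj₁ (finite i)))

      solution : ∀ x → K₀ ⊨ φ [ x ∷ᵛ v ] → Any (x ≈_) solutions
      solution x φ[x] = let i , x∈Z , x∈U = S⊆ {x ∷ᵛ []ᵛ} φ[x] in
        Anyₚ.concat⁺ (Anyₚ.tabulate⁺ i (proj₂ (finite i) (x ∷ᵛ []ᵛ) x∈Z x∈U))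

      a∈acl : a ∈ acl K₀ Constant
      a∈acl = n , φ , v , v-const , φ[a] , length solutions , lookup solutions ,
        λ x φ[x] → Any.index (solution x φ[x]) , Anyₚ.lookup-index (solution x φ[x])

-- The constants of a Boolean product

module ConstantSections (em : Classical) {ℓ : Level} {Const : Set ℓ} {R : ℕ → Set ℓ} {m : ℕ}
  {T : Theory (FieldLanguage Const R) ℓ} {χ : Formula (FieldLanguage Const R) (suc m)}
  (openT : IsOpenTheory T χ) (aclT : AclIsFieldAlgebraic T)
  (𝒜 : SubdirectProduct (FieldLanguageδ Const R) ℓ) (isΓδ : Γᵉ (ModelsT*δ T χ) 𝒜)
  (const∈C : ∀ κ → Structure.fun (SubdirectProduct.structure (reductᴾ 𝒜)) (const κ) []ᵛ ∈
                     constants 𝒜)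
  where

  private
    module 𝒜δ = SubdirectProduct 𝒜
    L = FieldLanguage Const R
    𝒜₀ : SubdirectProduct L ℓ
    𝒜₀ = reductᴾ 𝒜
  open SubdirectProduct 𝒜₀ renaming (structure to A) hiding (resp; closed)
  open Γᵉ isΓδ using (patchwork)
  open Ops A using (Carrier; 0#; 1#; _+_; _-_)

  private
    module Fib (x : Point) = Structure (fibre x)

    single : ∀ (a : Carrier) x i →
             Fib._≈_ x (proj₁ ((a ∷ᵛ []ᵛ) i) x) ((proj₁ a x ∷ᵛ []ᵛ) i)
    single a x zero = Fib.refl x

    pair : ∀ (a b : Carrier) x i →
           Fib._≈_ x (proj₁ ((a ∷ᵛ b ∷ᵛ []ᵛ) i) x) ((proj₁ a x ∷ᵛ proj₁ b x ∷ᵛ []ᵛ) i)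
    pair a b x zero       = Fib.refl x
    pair a b x (suc zero) = Fib.refl x

  ConstantAt : ∀ x → Pred (Structure.Carrier (fibre x)) ℓ
  ConstantAt x y = Fib._≈_ x (der (𝒜δ.fibre x) y) (Ops.0# (fibre x))

  private
    der-at : ∀ (a : Carrier) x →
             Fib._≈_ x (proj₁ (der 𝒜δ.structure a) x) (der (𝒜δ.fibre x) (proj₁ a x))
    der-at a x = Structure.fun-cong (𝒜δ.fibre x) (inj₂ δ) (single a x)

    zero-at : ∀ x → Fib._≈_ x (proj₁ 0# x) (Ops.0# (fibre x))
    zero-at x = Fib.fun-cong x zeroᶠ (λ ())

  constants⇔ : ∀ a → (a ∈ constants 𝒜) ⇔ (∀ x → proj₁ a x ∈ ConstantAt x)
  constants⇔ a = mk⇔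
    (λ h x → Fib.trans x (Fib.sym x (der-at a x)) (Fib.trans x (h x) (zero-at x)))
    (λ h x → Fib.trans x (der-at a x) (Fib.trans x (h x) (Fib.sym x (zero-at x))))

  const-constant : ∀ x κ → Structure.fun (fibre x) (const κ) []ᵛ ∈ ConstantAt x
  const-constant x κ = Fib.trans x
    (Structure.fun-cong (𝒜δ.fibre x) (inj₂ δ) (λ { zero → Fib.fun-cong x (const κ) (λ ()) }))
    (to (constants⇔ _) (const∈C κ) x)

  private
    module Fibre (x : Point) =
      GenericDerivation em openT aclT (𝒜δ.fibre x) (Γᵉ.models isΓδ x) (const-constant x)

  C-substructure : IsSubstructure A (constants 𝒜)
  C-substructure = record
    { resp   = λ {a} {b} e h → from (constants⇔ b)
                 (λ x → Fibre.constant-resp x (e x) (to (constants⇔ a) h x))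
    ; closed = λ F {v} h → from (constants⇔ (Structure.fun A F v))
                 (λ x → Fibre.constant-fun x F (λ i → to (constants⇔ (v i)) (h i) x))
    }

  private
    0#∈C : 0# ∈ constants 𝒜
    0#∈C = IsSubstructure.closed C-substructure zeroᶠ {[]ᵛ} (λ ())

    1#∈C : 1# ∈ constants 𝒜
    1#∈C = IsSubstructure.closed C-substructure oneᶠ {[]ᵛ} (λ ())

  isΓ : Γᵉ (_⊨ᵀ T) 𝒜₀
  isΓ = record
    { models    = λ x → ModelsT*δ.modelsT (Γᵉ.models isΓδ x)
    ; patchwork = patchwork
    ; clopen    = λ φ f → clopen-resp space
        ( (λ {x} → to (liftᶠ-reduct (𝒜δ.fibre x) φ _))
        , (λ {x} → from (liftᶠ-reduct (𝒜δ.fibre x) φ _)))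
        (Γᵉ.clopen isΓδ (liftᶠ φ) f)
    }

  open Γᵉ isΓ using (clopen)
  open BooleanProduct em 𝒜₀ isΓ

  ConstantSet : Carrier → Pred Point ℓ
  ConstantSet a x = proj₁ a x ∈ ConstantAt x

  constantSet-local : Local ConstantSet
  constantSet-local a b x = Fibre.constant-resp x

  -- This is the truth set of δ(y) = 0, hence clopen by the condition on formulas of the language
  -- with `δ`.
  constantSet-clopen : ∀ a → Clopen (ConstantSet a)
  constantSet-clopen a = clopen-resp space
    ( (λ {x} (lift h) → Fib.trans x (Fib.sym x (der-var x)) (Fib.trans x h (zero-cong x)))
    , (λ {x} h → lift (Fib.trans x (der-var x) (Fib.trans x h (Fib.sym x (zero-cong x))))))
    (Γᵉ.clopen isΓδ (fn (inj₂ δ) (λ _ → var zero) ≈′ fn (inj₁ zeroᶠ) (λ ())) (a ∷ᵛ []ᵛ))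
    where
    der-var : ∀ x → Fib._≈_ x (Structure.fun (𝒜δ.fibre x) (inj₂ δ) (λ _ → proj₁ a x))
                              (der (𝒜δ.fibre x) (proj₁ a x))
    der-var x = Structure.fun-cong (𝒜δ.fibre x) (inj₂ δ) (λ { zero → Fib.refl x })
    zero-cong : ∀ x {v} → Fib._≈_ x (Structure.fun (fibre x) zeroᶠ v) (Ops.0# (fibre x))
    zero-cong x = Fib.fun-cong x zeroᶠ (λ ())

  -- A constant y of the fibre at x is the value of a global constant: patch a
  -- section through y with 0 where it fails to be constant.
  image⇔ : ∀ x y → (y ∈ Image 𝒜₀ C-substructure x) ⇔ (y ∈ ConstantAt x)
  image⇔ x y = mk⇔ (λ (a , a∈C , e) → Fibre.constant-resp x e (to (constants⇔ a) a∈C x)) lifted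
    where
    lifted : y ∈ ConstantAt x → y ∈ Image 𝒜₀ C-substructure x
    lifted y-const with projects x y
    ... | f₀ , el , e with patchwork (f₀ , el) 0# (constantSet-clopen (f₀ , el))
    ...   | h , on , off = h , from (constants⇔ h) everywhere ,
            Fib.trans x (Fib.sym x (on (Fibre.constant-resp x (Fib.sym x e) y-const))) e
      where
      everywhere : ∀ x → x ∈ ConstantSet h
      everywhere x with decide em (x ∈ ConstantSet (f₀ , el))
      ... | yes z = constantSet-local (f₀ , el) h x (on z) z
      ... | no ¬z = constantSet-local 0# h x (off ¬z) (to (constants⇔ 0#) 0#∈C x)

  -- By `image⇔` the substructure consists of the constants of a model of T*_δ, for which
  -- `constant-witness` is the Tarski-Vaught test. It follows that these fibres are models of `T`
  -- and that truth sets computed in them are those of `𝒜`.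
  fibre-elementary : ∀ x → IsElementary (image-isSubstructure 𝒜₀ C-substructure x)
  fibre-elementary x = tarski-vaught (image-isSubstructure 𝒜₀ C-substructure x) em λ φ v v∈ a h →
    let b , b-const , h′ = Fibre.constant-witness x φ v (λ i → to (image⇔ x (v i)) (v∈ i)) a h in
    b , from (image⇔ x b) b-const , h′

  [[]]ᴰ≐[[]] : (φ : Formula L n) (f : Vector (Σ Carrier (constants 𝒜)) n) →
               [[_]]ᴰ 𝒜₀ C-substructure φ f ≐ [[ φ ]] (proj₁ ∘ f)
  [[]]ᴰ≐[[]] φ f = (λ {x} → to (fibre-elementary x φ _)) , (λ {x} → from (fibre-elementary x φ _))

  -- Any patch of `f` and `g` made in `𝒜` is already constant: at each point it takes one of their
  -- two values, and constancy is local.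
  constants-patchwork : ∀ f g → f ∈ constants 𝒜 → g ∈ constants 𝒜 → ∀ {U} → Clopen U →
    ∃[ h ] h ∈ constants 𝒜 × (U ⊆ Agree f h) × (∁ U ⊆ Agree g h)
  constants-patchwork f g f∈C g∈C {U} U-clopen with patchwork f g U-clopen
  ... | h , on , off = h , from (constants⇔ h) h-const , (λ {x} → on {x}) , (λ {x} → off {x})
    where
    h-const : ∀ x → x ∈ ConstantSet h
    h-const x with proj₂ (proj₂ U-clopen) x
    ... | yes u = constantSet-local f h x (on u) (to (constants⇔ f) f∈C x)
    ... | no ¬u = constantSet-local g h x (off ¬u) (to (constants⇔ g) g∈C x)

  -- A clopen set U is [ h = 1 ] for the constant h equal to 1 on U and to 0 elsewhere.
  clopenᴰ-full : ∀ U → U ∈ Clopenᴰ 𝒜₀ C-substructure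
  clopenᴰ-full (U , U-clopen) with constants-patchwork 1# 0# 1#∈C 0#∈C U-clopen
  ... | h , h∈C , on , off = 1 , is-one , f , (λ {x} → proj₂ ([[]]ᴰ≐[[]] is-one f) {x} ∘ U⊆ {x}) ,
                       (λ {x} → ⊆U {x} ∘ proj₁ ([[]]ᴰ≐[[]] is-one f) {x})
    where
    is-one : Formula L 1
    is-one = var zero ≈′ fn oneᶠ (λ ())

    f : Vector (Σ Carrier (constants 𝒜)) 1
    f _ = h , h∈C

    one-cong : ∀ x {v} → Fib._≈_ x (proj₁ 1# x) (Structure.fun (fibre x) oneᶠ v)
    one-cong x = Fib.fun-cong x oneᶠ (λ ())

    U⊆ : U ⊆ [[ is-one ]] (λ _ → h)
    U⊆ {x} u = lift (Fib.trans x (Fib.sym x (on u)) (one-cong x))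

    ⊆U : [[ is-one ]] (λ _ → h) ⊆ U
    ⊆U {x} (lift e) with proj₂ (proj₂ U-clopen) x
    ... | yes u = u
    -- Off `U` the section `h` is 0, so `h` = 1 there would give 0 = 1 in the fibre.
    ... | no ¬u = contradiction
      (Fib.trans x (Fib.sym x (zero-at x))
        (Fib.trans x (off ¬u) (Fib.trans x e (Fib.fun-cong x oneᶠ (λ ())))))
      (IsFieldOfChar0.0≉1 (IsOpenTheory.fields openT (fibre x) (Γᵉ.models isΓ x)))

  clopenᴰ-substructure : IsSubstructure (clopenAlgebra space) (Clopenᴰ 𝒜₀ C-substructure)
  clopenᴰ-substructure = record
    { resp   = λ {_} {V} _ _ → clopenᴰ-full V
    ; closed = λ F {v} _ → clopenᴰ-full (Structure.fun (clopenAlgebra space) F v)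
    }

  -- The subalgebra contains every clopen set, so each witness serves as its own replacement.
  clopenᴰ-elementary : IsElementary clopenᴰ-substructure
  clopenᴰ-elementary = tarski-vaught clopenᴰ-substructure em λ φ v _ U h → U , clopenᴰ-full U , h

  C-elementary : IsElementary C-substructure
  C-elementary = tarski-vaught C-substructure em λ {n} φ v v∈C a h →
    -- The parameters `v` are kept, and `a` is exchanged for an everywhere constant section with the
    -- same type over `v`, at every point, with respect to the determinants of `φ`.
    let b , b-const , same = realize-types ConstantSet constantSet-clopen constantSet-local
                               (determinants φ) a v v (λ x τ _ → realized v v∈C a x τ)
    in b , from (constants⇔ b) b-const , determined φ {a ∷ᵛ v} {b ∷ᵛ v} same h
    where
    realized : (v : Vector Carrier n) → (∀ i → v i ∈ constants 𝒜) →
      ∀ a x (τ : Formula L (suc n)) → fibre x ⊨ τ [ proj₁ a x ∷ᵛ at v x ] →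
      ∃[ b ] x ∈ ConstantSet b × fibre x ⊨ τ [ proj₁ b x ∷ᵛ at v x ]
    realized v v∈C a x τ t =
      let b₀ , b₀-const , t′ = Fibre.constant-witness x τ (at v x)
                                 (λ i → to (constants⇔ (v i)) (v∈C i) x) (proj₁ a x) t
          b , el , e = projects x b₀
      in (b , el) , Fibre.constant-resp x (Fib.sym x e) b₀-const ,
         ⊨-resp (fibre x) τ (λ { zero → Fib.sym x e ; (suc i) → Fib.refl x }) t′

  -- Being constant and lying in the ball around `r` is a clopen, local condition on a section `f`,
  -- solvable in every fibre by `constant-in-ball`; `patch-solutions` yields one global `f`, and the
  -- displacement is `f - r`.
  constants-dense : ∀ r (b : Vector Carrier m) → (∀ x → x ∈ [[ χ ]] (0# ∷ᵛ b)) →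
    ∃[ a ] (∀ x → x ∈ [[ χ ]] (a ∷ᵛ b)) × (r + a) ∈ constants 𝒜
  constants-dense r b χ0 =
    let f , h = patch-solutions 0# S S-clopen S-local solve in
    f - r , (λ x → proj₂ (h x)) ,
    IsSubstructure.resp C-substructure (λ x → r+[f-r] f x) (from (constants⇔ f) (λ x → proj₁ (h x)))
    where
    S : Carrier → Pred Point ℓ
    S f = ConstantSet f ∩ [[ χ ]] ((f - r) ∷ᵛ b)

    S-clopen : ∀ f → Clopen (S f)
    S-clopen f = clopen-∩ space (constantSet-clopen f) (clopen χ ((f - r) ∷ᵛ b))

    minus-at : ∀ f x →
               Fib._≈_ x (proj₁ (f - r) x) (Ops._-_ (fibre x) (proj₁ f x) (proj₁ r x))
    minus-at f x = Fib.trans x (Fib.fun-cong x addᶠ (pair f _ x))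
      (Fib.fun-cong x addᶠ λ { zero → Fib.refl x ; (suc zero) → Fib.fun-cong x negᶠ (single r x) })

    r+[f-r] : ∀ f x → Fib._≈_ x (proj₁ f x) (proj₁ (r + (f - r)) x)
    r+[f-r] f x = Fib.sym x (Fib.trans x
      (Fib.fun-cong x addᶠ (λ { zero → Fib.refl x ; (suc zero) → minus-at f x }))
      (Fibre.add-minus x (proj₁ r x) (proj₁ f x)))

    S-local : Local S
    S-local f g x e (const-f , h) = constantSet-local f g x e const-f ,
      ⊨-resp (fibre x) χ (λ { zero → Fib.fun-cong x addᶠ (λ { zero → e ; (suc zero) → Fib.refl x })
                            ; (suc i) → Fib.refl x }) h

    solve : ∀ x → ∃[ f ] x ∈ S f
    solve x =
      let c , c-const , h = Fibre.constant-in-ball x (proj₁ r x) (at b x)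
            (⊨-resp (fibre x) χ (λ { zero → zero-at x ; (suc i) → Fib.refl x }) (χ0 x))
          f₀ , el , e = projects x c
          f = f₀ , el
      in f , Fibre.constant-resp x (Fib.sym x e) c-const ,
         ⊨-resp (fibre x) χ (λ { zero → Fib.sym x (Fib.trans x (minus-at f x)
                                  (Fib.fun-cong x addᶠ (λ { zero → e ; (suc zero) → Fib.refl x })))
                               ; (suc i) → Fib.refl x }) h

  image-acl-closed : ∀ x → acl (fibre x) (Image 𝒜₀ C-substructure x) ⊆ Image 𝒜₀ C-substructure x
  image-acl-closed x {y} y∈acl = from (image⇔ x y)
    (Fibre.acl⊆constants x (Image 𝒜₀ C-substructure x) (λ {z} → to (image⇔ x z)) y∈acl)


proposition6p9 : Classical →
    {ℓ : Level} {Const : Set ℓ} {R : ℕ → Set ℓ} {m : ℕ}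
    (T : Theory (FieldLanguage Const R) ℓ)
    (χ : Formula (FieldLanguage Const R) (suc m))
    (χₚ : Formula (FieldLanguageₚ Const R) (suc m)) →
    Complete ℓ ℓ T →
    IsOpenTheory T χ →
    AclIsFieldAlgebraic T →
    HasHenselianExtensions T χ →
    NegatedRelationsPositive T →
    EliminatesQuantifiers T →
    IsLₚForm T χ χₚ →
    (T̃ : Theory LBA ℓ) →
    Complete (lsuc ℓ) ℓ T̃ →
    (∀ (B : Structure LBA (lsuc ℓ) ℓ) → B ⊨ᵀ T̃ → IsBooleanAlgebraStructure B) →
    (𝒜 : SubdirectProduct (FieldLanguageδ Const R) ℓ) →
    Γᵉ[ T̃ ] (ModelsT*δ T χ) 𝒜 →
    (∀ (κ : Const) → Structure.fun (SubdirectProduct.structure (reductᴾ 𝒜)) (const κ) []ᵛ ∈ constants 𝒜) →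
    Σ[ C ∈ IsSubstructure (SubdirectProduct.structure (reductᴾ 𝒜)) (constants 𝒜) ]
    IsDensePair (reductᴾ 𝒜) C T T̃ χₚ × IsElementary C
proposition6p9 em T χ χₚ _ openT aclT _ _ _ formₚ T̃ _ _ 𝒜 isΓδ const∈C =
  C-substructure , densePair , C-elementary
  where
  open ConstantSections em openT aclT 𝒜 (Γᵉ[_].isΓᵉ isΓδ) const∈C
  open SubdirectProduct (reductᴾ 𝒜) using (space; fibre)
  open IsLₚForm formₚ using (coordinatewise)

  densePair : IsDensePair (reductᴾ 𝒜) C-substructure T T̃ χₚ
  densePair = record
    { isΓᴬ       = record { isΓᵉ = isΓ ; algebra = Γᵉ[_].algebra isΓδ }
    ; modelsᴰ    = λ x φ φ∈T → from (fibre-elementary x φ []ᵛ)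
                     (⊨-resp (fibre x) φ (λ ()) (Γᵉ.models isΓ x φ φ∈T))
    ; clopenᴰ    = λ φ f → let p , q = [[]]ᴰ≐[[]] φ f in
                     clopen-resp space (q , p) (Γᵉ.clopen isΓ φ (proj₁ ∘ f))
    ; subalgebra = clopenᴰ-substructure
    ; patchworkᴰ = λ f g f∈C g∈C U _ → constants-patchwork f g f∈C g∈C (proj₂ U)
    ; algebraᴰ   = λ φ φ∈T̃ → from (clopenᴰ-elementary φ []ᵛ)
                     (⊨-resp (clopenAlgebra space) φ (λ ()) (Γᵉ[_].algebra isΓδ φ φ∈T̃))
    ; D1         = clopenᴰ-elementary
    ; D2         = image-acl-closed
    -- `coordinatewise` turns `χₚ` on the product into `χ` at every point, and back.
    ; D3         = λ r b χₚ0 →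
        let a , χa , r+a∈C = constants-dense r b (to (coordinatewise (reductᴾ 𝒜) isΓ _) χₚ0) in
        a , from (coordinatewise (reductᴾ 𝒜) isΓ _) χa , r+a∈C
    -- Every clopen set comes from the constants, so `e` itself serves.
    ; D4         = λ x e x∈e → e , clopenᴰ-full e , x∈e , id
    }
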